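{- For every integer $k\ge 2$ and every tree $T$ with maximum degree at most $k$, we have $$g(n,T,S_{k+1})=ex(n,T,S_{k+1})-O_{k,T}(1),$$ i.e. there is a constant $c=c(k,T)$ such that $ex(n,T,S_{k+1})-c\le g(n,T,S_{k+1})\le ex(n,T,S_{k+1})$ for all $n$.
   Context: $S_{k+1}$ denotes the star with $k+1$ leaves. For graphs $H,F$, $ex(n,H,F)$ is the maximum number of copies of $H$ (as subgraphs) in an $n$-vertex graph containing no copy of $F$ as a subgraph. For fixed graphs $H$ and $F$, the Constructor–Blocker game is played on the edge set of $K_n$: Constructor and Blocker alternately claim previously unclaimed edges, Constructor moving first. Constructor may only claim an edge if after claiming it his graph (all edges he has claimed) contains no copy of $F$; Blocker may claim any unclaimed edge. The game ends when Constructor cannot claim a further edge or all edges are claimed. The score is the number of copies of $H$ all of whose edges were claimed by Constructor. Constructor maximizes, Blocker minimizes the score; $g(n,H,F)$ is the score under optimal play by both players. -}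

module Defs where

open import Data.Bool using (Bool; true; false; _∧_; _∨_; not; if_then_else_)
open import Data.Nat using (ℕ; zero; suc; _+_; _≤_; _<_; _⊔_; _⊓_)
open import Data.Nat as ℕ using ()
open import Data.Fin using (Fin; zero; suc; toℕ)
open import Data.Fin as F using ()
open import Data.Product using (_×_; _,_; proj₁; proj₂)
open import Data.List using (List; []; _∷_; map; filter; length; allFin; concatMap; foldr; _++_; cartesianProduct; filterᵇ)
open import Data.Bool.ListAction using (any; all)
open import Data.List.Relation.Unary.All using (All)
open import Data.List.Relation.Unary.Unique.Propositional using (Unique)
open import Relation.Nullary.Decidable using (⌊_⌋)
open import Relation.Binary.PropositionalEquality using (_≡_)

-- Graphs: a graph on the vertex set Fin m is given by its list of edges;
-- an edge (u , v) is stored with toℕ u < toℕ v (see IsSimple).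

Edge : ℕ → Set
Edge m = Fin m × Fin m

Graph : ℕ → Set
Graph m = List (Edge m)

_=ᶠ_ : ∀ {m} → Fin m → Fin m → Bool
i =ᶠ j = ⌊ i F.≟ j ⌋

adj : ∀ {m} → Graph m → Fin m → Fin m → Bool
adj G u v = any (λ e → ((proj₁ e =ᶠ u) ∧ (proj₂ e =ᶠ v)) ∨ ((proj₁ e =ᶠ v) ∧ (proj₂ e =ᶠ u))) G

IsSimple : ∀ {m} → Graph m → Set
IsSimple G = All (λ e → toℕ (proj₁ e) < toℕ (proj₂ e)) G × Unique G

data Walk {m} (G : Graph m) : Fin m → Fin m → Set where
  here : ∀ {u} → Walk G u u
  step : ∀ {u w v} → adj G u w ≡ true → Walk G w v → Walk G u v

Connected : ∀ {m} → Graph m → Set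
Connected {m} G = ∀ (u v : Fin m) → Walk G u v

IsTree : (m : ℕ) → Graph m → Set
IsTree m G = IsSimple G × Connected G × (length G + 1 ≡ m)

deg : ∀ {m} → Graph m → Fin m → ℕ
deg G v = length (filterᵇ (λ e → (proj₁ e =ᶠ v) ∨ (proj₂ e =ᶠ v)) G)

MaxDegAtMost : ∀ {m} → Graph m → ℕ → Set
MaxDegAtMost {m} G k = ∀ (v : Fin m) → deg G v ≤ k

star : (l : ℕ) → Graph (suc l)
star l = map (λ i → (zero , suc i)) (allFin l)

allMaps : (t n : ℕ) → List (Fin t → Fin n)
allMaps zero    n = (λ ()) ∷ []
allMaps (suc t) n = concatMap (λ f → map (λ a → cons a f) (allFin n)) (allMaps t n)
  where
  cons : Fin n → (Fin t → Fin n) → Fin (suc t) → Fin n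
  cons a f zero    = a
  cons a f (suc i) = f i

allB : ∀ {m} → (Fin m → Bool) → Bool
allB {m} p = all p (allFin m)

anyB : ∀ {m} → (Fin m → Bool) → Bool
anyB {m} p = any p (allFin m)

injectiveᵇ : ∀ {t n} → (Fin t → Fin n) → Bool
injectiveᵇ f = allB (λ x → allB (λ y → not (f x =ᶠ f y) ∨ (x =ᶠ y)))

homᵇ : ∀ {t n} → Graph t → Graph n → (Fin t → Fin n) → Bool
homᵇ H G f = all (λ e → adj G (f (proj₁ e)) (f (proj₂ e))) H

embeddings : ∀ {t n} → Graph t → Graph n → List (Fin t → Fin n)
embeddings {t} {n} H G = filterᵇ (λ f → injectiveᵇ f ∧ homᵇ H G f) (allMaps t n)

inImgV : ∀ {t n} → (Fin t → Fin n) → Fin n → Bool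
inImgV f v = anyB (λ x → f x =ᶠ v)

inImgE : ∀ {t n} → Graph t → (Fin t → Fin n) → Fin n → Fin n → Bool
inImgE H f u v = adj (map (λ e → (f (proj₁ e) , f (proj₂ e))) H) u v

_⇔ᵇ_ : Bool → Bool → Bool
a ⇔ᵇ b = (a ∧ b) ∨ (not a ∧ not b)

sameCopy : ∀ {t n} → Graph t → (Fin t → Fin n) → (Fin t → Fin n) → Bool
sameCopy H f g =
  allB (λ v → inImgV f v ⇔ᵇ inImgV g v) ∧
  allB (λ u → allB (λ v → inImgE H f u v ⇔ᵇ inImgE H g u v))

countClasses : ∀ {A : Set} → (A → A → Bool) → List A → ℕ
countClasses eq []       = 0
countClasses eq (x ∷ xs) = if any (eq x) xs then countClasses eq xs else suc (countClasses eq xs)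

copies : ∀ {t n} → Graph t → Graph n → ℕ
copies H G = countClasses (sameCopy H) (embeddings H G)

freeᵇ : ∀ {s n} → Graph s → Graph n → Bool
freeᵇ F G = copies F G ℕ.≡ᵇ 0

allEdges : (n : ℕ) → Graph n
allEdges n = filterᵇ (λ e → toℕ (proj₁ e) ℕ.<ᵇ toℕ (proj₂ e)) (cartesianProduct (allFin n) (allFin n))

sublists : ∀ {A : Set} → List A → List (List A)
sublists []       = [] ∷ []
sublists (x ∷ xs) = let r = sublists xs in r ++ map (x ∷_) r

maxL : List ℕ → ℕ
maxL = foldr _⊔_ 0

ex : ∀ {t s} → (n : ℕ) → Graph t → Graph s → ℕ
ex n H F = maxL (map (copies H) (filterᵇ (freeᵇ F) (sublists (allEdges n))))

memE : ∀ {n} → Edge n → Graph n → Bool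
memE e G = any (λ e' → (proj₁ e =ᶠ proj₁ e') ∧ (proj₂ e =ᶠ proj₂ e')) G

unclaimed : (n : ℕ) → Graph n → Graph n → Graph n
unclaimed n C B = filterᵇ (λ e → not (memE e C) ∧ not (memE e B)) (allEdges n)

-- value of the game under optimal play.
-- fuel bounds the number of remaining moves (each move claims an edge);
-- C = Constructor's edges, B = Blocker's edges.
mutual
  constructorTurn : ∀ {t s} → (n : ℕ) → Graph t → Graph s → ℕ → Graph n → Graph n → ℕ
  constructorTurn n H F zero     C B = copies H C
  constructorTurn n H F (suc fu) C B with filterᵇ (λ e → freeᵇ F (e ∷ C)) (unclaimed n C B)
  ... | []     = copies H C
  ... | e ∷ es = foldr (λ e' acc → acc ⊔ blockerTurn n H F fu (e' ∷ C) B)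
                       (blockerTurn n H F fu (e ∷ C) B) es

  blockerTurn : ∀ {t s} → (n : ℕ) → Graph t → Graph s → ℕ → Graph n → Graph n → ℕ
  blockerTurn n H F zero     C B = copies H C
  blockerTurn n H F (suc fu) C B with unclaimed n C B
  ... | []     = copies H C
  ... | e ∷ es = foldr (λ e' acc → acc ⊓ constructorTurn n H F fu C (e' ∷ B))
                       (constructorTurn n H F fu C (e ∷ B)) es

g : ∀ {t s} → (n : ℕ) → Graph t → Graph s → ℕ
g n H F = constructorTurn n H F (length (allEdges n)) [] []

module Submission where

-- Let deficit v = k - deg v in Constructor's graph C. Constructor only joins deficient vertices at distance
-- more than t, so that C has maximum degree at most k and large girth. To avoid being stuck while the slack
-- W = Σ deficit is large, she watches the danger Φ = Σ deficit u * deficit v over the ordered pairs uv claimed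
-- by Blocker: a Blocker move adds at most 2 k², while joining x and y removes twice the threats
-- Σ deficit u over the Blocker neighbours u of x and of y. With x most threatened and y available for x and
-- threatened at least k² if possible, Φ ≤ (k² + 1) W is preserved down to a constant value of W, and no
-- threat grows beyond half of W.
--
-- Explore the tree T from a root, each new vertex having exactly one earlier neighbour. Bounding the choices
-- at each step shows that a graph of maximum degree k has at most n w embeddings of T, where w depends on T
-- and k only, and that every root image far from deficient vertices of C contributes exactly w embeddings.
-- All but O(1) vertices are such, and embeddings are counted by |Aut T| times the number of copies.

open import Defs
open import Data.Bool using (Bool; true; false; _∧_; _∨_; not; if_then_else_)
open import Data.Bool.ListAction using (any; all)
open import Data.Bool.Properties using (T-≡; ∨-zeroʳ; T?)
open import Data.Empty using (⊥; ⊥-elim)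
open import Data.Fin using (Fin; zero; suc; toℕ; inject≤)
import Data.Fin.Properties as Finₚ
open import Data.Fin.Properties using () renaming (_≟_ to _≟ᶠ_)
open import Data.List using (List; []; _∷_; map; length; allFin; concatMap; foldr; _++_; cartesianProduct; filterᵇ; lookup; tabulate)
open import Data.List.Membership.Propositional using (_∈_; _∉_; find; lose)
import Data.List.Membership.DecPropositional as DecMembership
open import Data.List.Membership.Propositional.Properties using (∈-allFin; ∈-map⁺; ∈-map⁻; ∈-concatMap⁺; ∈-concatMap⁻; ∈-filter⁺; ∈-filter⁻; ∈-++⁺ˡ; ∈-++⁺ʳ; ∈-++⁻; ∈-cartesianProduct⁺; ∈-∃++; ∈-lookup)
open import Data.List.Properties using (length-++; length-map; length-tabulate; length-filter)
open import Data.List.Relation.Unary.All as All using (All; []; _∷_)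
open import Data.List.Relation.Unary.Any using (here; there)
open import Data.List.Relation.Unary.Any.Properties using (any⁺; any⁻)
open import Data.List.Relation.Unary.AllPairs as AllPairs using (AllPairs; []; _∷_)
import Data.List.Relation.Unary.AllPairs.Properties as AllPairsₚ
open import Data.List.Relation.Unary.Unique.Propositional using (Unique)
import Data.List.Relation.Unary.Unique.Propositional.Properties as Uniqueₚ
open import Data.Nat
open import Data.Nat.Properties
open import Algebra.Properties.Semiring.Sum +-*-semiring using (sum; sum-cong-≗; ∑-distrib-+; ∑-comm; *-distribˡ-sum; *-distribʳ-sum)
open import Data.Nat.Tactic.RingSolver using (solve-∀)
open import Data.Product using (∃-syntax; _×_; _,_; proj₁; proj₂)
open import Data.Sum using (_⊎_; inj₁; inj₂)
open import Function using (_∘_; id)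
open import Function.Bundles using (Equivalence)
open import Relation.Binary.Definitions using (tri<; tri≈; tri>)
open import Relation.Binary.PropositionalEquality
open import Relation.Nullary using (¬_; ¬?; Dec; yes; no; contradiction)

-- Blocker's hope is to claim all edges between deficient vertices while `W` is still large. Then
-- `Φ` would be of order W², although each edge of Blocker adds only a bounded amount.
--
-- A move of Constructor lowers `W` by 2, so to keep `Φ ≤ c W` against a reply worth 2 k² it
-- suffices that the threats to x and y add up to k² + c, or that `Φ` is well below the bound.
--
-- This controls only the average threat, and Blocker could still isolate a single vertex. A second
-- invariant therefore adds `Φ` to a multiple of each threat: the largest threat need not drop in a
-- move, but `Φ` drops by at least twice its value.
--
-- In the counting, the same w bounds the embeddings from above in every competitor and from below
-- in Constructor's graph, so `ex` and `g` are compared through n w and neither is computed.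

private
  variable
    A B : Set
    m n t : ℕ


-- Booleans, lists and finite counting

bool-ext : ∀ {p q} → (p ≡ true → q ≡ true) → (q ≡ true → p ≡ true) → p ≡ q
bool-ext {true}  {true}  f g = refl
bool-ext {true}  {false} f g = sym (f refl)
bool-ext {false} {true}  f g = g refl
bool-ext {false} {false} f g = refl

true≢false : ∀ {p} → p ≡ true → p ≡ false → ⊥
true≢false refl ()

∧-true⁻ : ∀ {p q} → p ∧ q ≡ true → p ≡ true × q ≡ true
∧-true⁻ {true} {true} refl = refl , refl

∧-true⁺ : ∀ {p q} → p ≡ true → q ≡ true → p ∧ q ≡ true
∧-true⁺ refl refl = refl

∨-true⁻ : ∀ {p q} → p ∨ q ≡ true → p ≡ true ⊎ q ≡ true
∨-true⁻ {true}  _ = inj₁ refl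
∨-true⁻ {false} h = inj₂ h

∨-true⁺ˡ : ∀ {p q} → p ≡ true → p ∨ q ≡ true
∨-true⁺ˡ refl = refl

∨-true⁺ʳ : ∀ p {q} → q ≡ true → p ∨ q ≡ true
∨-true⁺ʳ p refl = ∨-zeroʳ p

not-true⁻ : ∀ {p} → not p ≡ true → p ≡ false
not-true⁻ {false} _ = refl

not-true⁺ : ∀ {p} → p ≡ false → not p ≡ true
not-true⁺ refl = refl

≢true⇒false : ∀ {p} → ¬ p ≡ true → p ≡ false
≢true⇒false {true}  h = contradiction refl h
≢true⇒false {false} h = refl

=ᶠ⇒≡ : {i j : Fin n} → (i =ᶠ j) ≡ true → i ≡ j
=ᶠ⇒≡ {i = i} {j} h with i ≟ᶠ j
... | yes p = p

=ᶠ-refl : (i : Fin n) → (i =ᶠ i) ≡ true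
=ᶠ-refl i with i ≟ᶠ i
... | yes _ = refl
... | no ¬p = contradiction refl ¬p

≡⇒=ᶠ : {i j : Fin n} → i ≡ j → (i =ᶠ j) ≡ true
≡⇒=ᶠ {i = i} refl = =ᶠ-refl i

≢⇒=ᶠ-false : {i j : Fin n} → ¬ i ≡ j → (i =ᶠ j) ≡ false
≢⇒=ᶠ-false i≢j = ≢true⇒false (i≢j ∘ =ᶠ⇒≡)

any-true⁻ : (p : A → Bool) (xs : List A) → any p xs ≡ true → ∃[ x ] x ∈ xs × p x ≡ true
any-true⁻ p xs h = let x , x∈ , px = find (any⁻ p xs (Equivalence.from T-≡ h)) in x , x∈ , Equivalence.to T-≡ px

any-true⁺ : (p : A → Bool) {xs : List A} {x : A} → x ∈ xs → p x ≡ true → any p xs ≡ true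
any-true⁺ p x∈ px = Equivalence.to T-≡ (any⁺ p (lose x∈ (Equivalence.from T-≡ px)))

all-true⁻ : (p : A → Bool) {xs : List A} {x : A} → all p xs ≡ true → x ∈ xs → p x ≡ true
all-true⁻ p h (here refl) = proj₁ (∧-true⁻ h)
all-true⁻ p h (there x∈) = all-true⁻ p (proj₂ (∧-true⁻ h)) x∈

all-true⁺ : (p : A → Bool) (xs : List A) → (∀ x → x ∈ xs → p x ≡ true) → all p xs ≡ true
all-true⁺ p []       h = refl
all-true⁺ p (x ∷ xs) h = ∧-true⁺ (h x (here refl)) (all-true⁺ p xs (λ y → h y ∘ there))

allB⁻ : {p : Fin n → Bool} → allB p ≡ true → ∀ x → p x ≡ true
allB⁻ {p = p} h x = all-true⁻ p h (∈-allFin x)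

allB⁺ : {p : Fin n → Bool} → (∀ x → p x ≡ true) → allB p ≡ true
allB⁺ {n} {p} h = all-true⁺ p (allFin n) (λ x _ → h x)

anyB⁻ : {p : Fin n → Bool} → anyB p ≡ true → ∃[ x ] p x ≡ true
anyB⁻ {n} {p} h = let x , _ , px = any-true⁻ p (allFin n) h in x , px

anyB⁺ : {p : Fin n → Bool} {x : Fin n} → p x ≡ true → anyB p ≡ true
anyB⁺ {p = p} {x} = any-true⁺ p (∈-allFin x)

∈-filterᵇ⁺ : (p : A → Bool) {xs : List A} {x : A} → x ∈ xs → p x ≡ true → x ∈ filterᵇ p xs
∈-filterᵇ⁺ p x∈ px = ∈-filter⁺ (T? ∘ p) x∈ (Equivalence.from T-≡ px)

∈-filterᵇ⁻ : (p : A → Bool) (xs : List A) {x : A} → x ∈ filterᵇ p xs → x ∈ xs × p x ≡ true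
∈-filterᵇ⁻ p xs x∈ = let x∈xs , px = ∈-filter⁻ (T? ∘ p) x∈ in x∈xs , Equivalence.to T-≡ px

filterᵇ-cong : {p q : A → Bool} → (∀ x → p x ≡ q x) → (xs : List A) → filterᵇ p xs ≡ filterᵇ q xs
filterᵇ-cong         h []       = refl
filterᵇ-cong {p = p} {q} h (x ∷ xs) with p x | q x | h x
... | true  | true  | _ = cong (x ∷_) (filterᵇ-cong h xs)
... | false | false | _ = filterᵇ-cong h xs

filterᵇ-unique : (p : A → Bool) {xs : List A} → Unique xs → Unique (filterᵇ p xs)
filterᵇ-unique p = Uniqueₚ.filter⁺ _

length-filterᵇ≤ : (p : A → Bool) (xs : List A) → length (filterᵇ p xs) ≤ length xs
length-filterᵇ≤ p = length-filter (T? ∘ p)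

length-filterᵇ-mono : {p q : A → Bool} → (∀ x → p x ≡ true → q x ≡ true) → (xs : List A) →
                      length (filterᵇ p xs) ≤ length (filterᵇ q xs)
length-filterᵇ-mono h [] = z≤n
length-filterᵇ-mono {p = p} {q} h (x ∷ xs) with p x in eqp | q x in eqq
... | true  | true  = s≤s (length-filterᵇ-mono h xs)
... | true  | false = ⊥-elim (true≢false (h x eqp) eqq)
... | false | true  = m≤n⇒m≤1+n (length-filterᵇ-mono h xs)
... | false | false = length-filterᵇ-mono h xs

length-filterᵇ-strict : {p q : A → Bool} → (∀ x → p x ≡ true → q x ≡ true) → {xs : List A} {y : A} → y ∈ xs →
                        q y ≡ true → p y ≡ false → length (filterᵇ p xs) < length (filterᵇ q xs)
length-filterᵇ-strict {p = p} {q} h {x ∷ xs} (here refl) qy py rewrite qy | py = s≤s (length-filterᵇ-mono h xs)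
length-filterᵇ-strict {p = p} {q} h {x ∷ xs} (there y∈) qy py with p x in eqp | q x in eqq
... | true  | true  = s≤s (length-filterᵇ-strict h y∈ qy py)
... | true  | false = ⊥-elim (true≢false (h x eqp) eqq)
... | false | true  = m≤n⇒m≤1+n (length-filterᵇ-strict h y∈ qy py)
... | false | false = length-filterᵇ-strict h y∈ qy py

-- Pigeonhole along a relation in place of an injection, because maps will be compared by `≗` and
-- not by `≡`. Each element of `xs` uses up a match of its own, which is removed from `ys` before
-- the next one.
match-length≤ : {R : A → A → Set} (M : A → B → Set) {xs : List A} {ys : List B} → AllPairs R xs →
                (∀ {x} → x ∈ xs → ∃[ y ] y ∈ ys × M x y) →
                (∀ {x x′ y} → R x x′ → M x y → M x′ y → ⊥) → length xs ≤ length ys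
match-length≤ M [] total inj = z≤n
match-length≤ M {x ∷ xs} (Rx ∷ Rxs) total inj with total (here refl)
... | y , y∈ , Mxy with ∈-∃++ y∈
... | us , vs , refl = ≤-trans (s≤s (match-length≤ M Rxs total′ inj)) (≤-reflexive eq)
  where
  total′ : ∀ {x′} → x′ ∈ xs → ∃[ z ] z ∈ us ++ vs × M x′ z
  total′ x′∈ with total (there x′∈)
  ... | z , z∈ , Mx′z with ∈-++⁻ us z∈
  ... | inj₁ z∈us         = z , ∈-++⁺ˡ z∈us , Mx′z
  ... | inj₂ (here refl)  = ⊥-elim (inj (All.lookup Rx x′∈) Mxy Mx′z)
  ... | inj₂ (there z∈vs) = z , ∈-++⁺ʳ us z∈vs , Mx′z
  eq : suc (length (us ++ vs)) ≡ length (us ++ y ∷ vs)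
  eq = trans (cong suc (length-++ us)) (trans (sym (+-suc (length us) _)) (sym (length-++ us)))

Unique-⊆⇒length≤ : {xs ys : List A} → Unique xs → (∀ {x} → x ∈ xs → x ∈ ys) → length xs ≤ length ys
Unique-⊆⇒length≤ u sub = match-length≤ _≡_ u (λ x∈ → _ , sub x∈ , refl) (λ x≢x′ p q → x≢x′ (trans p (sym q)))

Unique-map : (f : A → B) {xs : List A} → (∀ {x y} → x ∈ xs → y ∈ xs → f x ≡ f y → x ≡ y) → Unique xs → Unique (map f xs)
Unique-map f inj [] = []
Unique-map f {x ∷ xs} inj (x∉ ∷ u) =
  All.tabulate (λ z∈ fx≡z → let y , y∈ , eq = ∈-map⁻ f z∈ in
    All.lookup x∉ y∈ (inj (here refl) (there y∈) (trans fx≡z eq)))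
  ∷ Unique-map f (λ a b → inj (there a) (there b)) u

concatMap⁻ : (f : A → List B) (xs : List A) {z : B} → z ∈ concatMap f xs → ∃[ x ] x ∈ xs × z ∈ f x
concatMap⁻ f xs z∈ = find (∈-concatMap⁻ f z∈)

concatMap⁺ : (f : A → List B) {xs : List A} {x : A} {z : B} → x ∈ xs → z ∈ f x → z ∈ concatMap f xs
concatMap⁺ f x∈ z∈ = ∈-concatMap⁺ f (lose x∈ z∈)

AllPairs-concatMap : {R : A → A → Set} {S : B → B → Set} (f : A → List B) {xs : List A} → AllPairs R xs →
                     (∀ x → AllPairs S (f x)) →
                     (∀ {x y a b} → R x y → a ∈ f x → b ∈ f y → S a b) → AllPairs S (concatMap f xs)
AllPairs-concatMap f [] Sf h = []
AllPairs-concatMap f {x ∷ xs} (Rx ∷ Rxs) Sf h =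
  AllPairsₚ.++⁺ (Sf x) (AllPairs-concatMap f Rxs Sf h)
    (All.tabulate (λ a∈ → All.tabulate (λ b∈ → let y , y∈ , b∈fy = concatMap⁻ f xs b∈ in
      h (All.lookup Rx y∈) a∈ b∈fy)))

length-concatMap≤ : (f : A → List B) (b : ℕ) (xs : List A) → (∀ {x} → x ∈ xs → length (f x) ≤ b) →
                    length (concatMap f xs) ≤ length xs * b
length-concatMap≤ f b []       h = z≤n
length-concatMap≤ f b (x ∷ xs) h =
  ≤-trans (≤-reflexive (length-++ (f x))) (+-mono-≤ (h (here refl)) (length-concatMap≤ f b xs (h ∘ there)))

length-concatMap≥ : (f : A → List B) (b : ℕ) (xs : List A) → (∀ {x} → x ∈ xs → b ≤ length (f x)) →
                    length xs * b ≤ length (concatMap f xs)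
length-concatMap≥ f b []       h = z≤n
length-concatMap≥ f b (x ∷ xs) h =
  ≤-trans (+-mono-≤ (h (here refl)) (length-concatMap≥ f b xs (h ∘ there))) (≤-reflexive (sym (length-++ (f x))))

-- Adjacency and the edges of the complete graph

adj⁻ : {G : Graph n} {u v : Fin n} → adj G u v ≡ true → (u , v) ∈ G ⊎ (v , u) ∈ G
adj⁻ {G = G} h with any-true⁻ _ G h
... | (a , b) , e∈ , p with ∨-true⁻ p
... | inj₁ q = let a≡ , b≡ = ∧-true⁻ q in inj₁ (subst (_∈ G) (cong₂ _,_ (=ᶠ⇒≡ a≡) (=ᶠ⇒≡ b≡)) e∈)
... | inj₂ q = let a≡ , b≡ = ∧-true⁻ q in inj₂ (subst (_∈ G) (cong₂ _,_ (=ᶠ⇒≡ a≡) (=ᶠ⇒≡ b≡)) e∈)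

adj⁺ : {G : Graph n} {u v : Fin n} → (u , v) ∈ G → adj G u v ≡ true
adj⁺ {u = u} {v} e∈ = any-true⁺ _ e∈ (∨-true⁺ˡ (∧-true⁺ (=ᶠ-refl u) (=ᶠ-refl v)))

adj⁺′ : {G : Graph n} {u v : Fin n} → (v , u) ∈ G → adj G u v ≡ true
adj⁺′ {u = u} {v} e∈ = any-true⁺ _ e∈ (∨-true⁺ʳ _ (∧-true⁺ (=ᶠ-refl v) (=ᶠ-refl u)))

adj-sym⁺ : {G : Graph n} {u v : Fin n} → adj G u v ≡ true → adj G v u ≡ true
adj-sym⁺ {G = G} h with adj⁻ {G = G} h
... | inj₁ e = adj⁺′ e
... | inj₂ e = adj⁺ e

adj-sym : (G : Graph n) (u v : Fin n) → adj G u v ≡ adj G v u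
adj-sym G u v = bool-ext (adj-sym⁺ {G = G}) (adj-sym⁺ {G = G})

memE⁻ : {e : Edge n} {G : Graph n} → memE e G ≡ true → e ∈ G
memE⁻ {e = e} {G} h with any-true⁻ _ G h
... | (a , b) , e∈ , p = let a≡ , b≡ = ∧-true⁻ p in subst (_∈ G) (sym (cong₂ _,_ (=ᶠ⇒≡ a≡) (=ᶠ⇒≡ b≡))) e∈

memE⁺ : {e : Edge n} {G : Graph n} → e ∈ G → memE e G ≡ true
memE⁺ {e = u , v} e∈ = any-true⁺ _ e∈ (∧-true⁺ (=ᶠ-refl u) (=ᶠ-refl v))

∈-allEdges⁻ : {u v : Fin n} → (u , v) ∈ allEdges n → toℕ u < toℕ v
∈-allEdges⁻ {n} {u} {v} e∈ =
  <ᵇ⇒< (toℕ u) (toℕ v) (Equivalence.from T-≡ (proj₂ (∈-filterᵇ⁻ _ (cartesianProduct (allFin n) (allFin n)) e∈)))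

∈-allEdges⁺ : {u v : Fin n} → toℕ u < toℕ v → (u , v) ∈ allEdges n
∈-allEdges⁺ {u = u} {v} u<v =
  ∈-filterᵇ⁺ _ (∈-cartesianProduct⁺ (∈-allFin u) (∈-allFin v)) (Equivalence.to T-≡ (<⇒<ᵇ u<v))

χ : Bool → ℕ
χ p = if p then 1 else 0

-- Embeddings and copies

IsEmbedding : Graph t → Graph n → (Fin t → Fin n) → Set
IsEmbedding H G f = (∀ {x y} → f x ≡ f y → x ≡ y) × (∀ {u v} → adj H u v ≡ true → adj G (f u) (f v) ≡ true)

Distinct : List (Fin t → Fin n) → Set
Distinct = AllPairs (λ f h → ¬ f ≗ h)

allMaps-complete : (f : Fin t → Fin n) → ∃[ f′ ] f′ ∈ allMaps t n × f′ ≗ f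
allMaps-complete {zero}  f = _ , here refl , λ ()
allMaps-complete {suc t} f with allMaps-complete (f ∘ suc)
... | f′ , f′∈ , f′≗ = _ , concatMap⁺ _ f′∈ (∈-map⁺ _ (∈-allFin (f zero))) , λ { zero → refl ; (suc i) → f′≗ i }

allMaps-distinct : ∀ t n → Distinct (allMaps t n)
allMaps-distinct zero    n = [] ∷ []
allMaps-distinct (suc t) n = AllPairs-concatMap _ (allMaps-distinct t n)
  (λ f → AllPairsₚ.map⁺ (AllPairs.map (λ a≢b h → a≢b (h zero)) (Uniqueₚ.allFin⁺ n)))
  (λ f≇h a∈ b∈ a≗b → f≇h (tails a∈ b∈ (λ _ _ → refl) (λ _ _ → refl) a≗b))
  where
  -- `φ` and `ψ` stand for the prepending maps inside `allMaps`; only their action on successors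
  -- matters.
  tails : ∀ {f h : Fin t → Fin n} {φ ψ : Fin n → Fin (suc t) → Fin n} {a b} {as bs : List (Fin n)} →
          a ∈ map φ as → b ∈ map ψ bs →
          (∀ x i → φ x (suc i) ≡ f i) → (∀ x i → ψ x (suc i) ≡ h i) → a ≗ b → f ≗ h
  tails a∈ b∈ φ≡ ψ≡ a≗b i with _ , _ , refl ← ∈-map⁻ _ a∈ with _ , _ , refl ← ∈-map⁻ _ b∈ =
    trans (sym (φ≡ _ i)) (trans (a≗b (suc i)) (ψ≡ _ i))

injectiveᵇ⁻ : {f : Fin t → Fin n} → injectiveᵇ f ≡ true → ∀ {x y} → f x ≡ f y → x ≡ y
injectiveᵇ⁻ {f = f} h {x} {y} fx≡fy with ∨-true⁻ (allB⁻ (allB⁻ h x) y)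
... | inj₁ p = ⊥-elim (true≢false (≡⇒=ᶠ fx≡fy) (not-true⁻ p))
... | inj₂ p = =ᶠ⇒≡ p

injectiveᵇ⁺ : {f : Fin t → Fin n} → (∀ {x y} → f x ≡ f y → x ≡ y) → injectiveᵇ f ≡ true
injectiveᵇ⁺ {f = f} h = allB⁺ λ x → allB⁺ λ y → lemma x y
  where
  lemma : ∀ x y → not (f x =ᶠ f y) ∨ (x =ᶠ y) ≡ true
  lemma x y with f x =ᶠ f y in eq
  ... | true  = ≡⇒=ᶠ (h (=ᶠ⇒≡ eq))
  ... | false = refl

homᵇ⁻ : {H : Graph t} {G : Graph n} {f : Fin t → Fin n} → homᵇ H G f ≡ true →
        ∀ {u v} → adj H u v ≡ true → adj G (f u) (f v) ≡ true
homᵇ⁻ {H = H} {G} h uv with adj⁻ {G = H} uv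
... | inj₁ e = all-true⁻ _ h e
... | inj₂ e = adj-sym⁺ {G = G} (all-true⁻ _ h e)

homᵇ⁺ : {H : Graph t} {G : Graph n} {f : Fin t → Fin n} →
        (∀ {u v} → adj H u v ≡ true → adj G (f u) (f v) ≡ true) → homᵇ H G f ≡ true
homᵇ⁺ {H = H} h = all-true⁺ _ H (λ _ e∈ → h (adj⁺ e∈))

∈-embeddings⁻ : {H : Graph t} {G : Graph n} {f : Fin t → Fin n} → f ∈ embeddings H G → IsEmbedding H G f
∈-embeddings⁻ {t} {n} {H} {G} f∈ =
  let i , h = ∧-true⁻ (proj₂ (∈-filterᵇ⁻ _ (allMaps t n) f∈)) in injectiveᵇ⁻ i , homᵇ⁻ {H = H} {G} h

∈-embeddings⁺ : {H : Graph t} {G : Graph n} {f : Fin t → Fin n} → IsEmbedding H G f → ∃[ f′ ] f′ ∈ embeddings H G × f′ ≗ f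
∈-embeddings⁺ {H = H} {G} {f} (i , h) with allMaps-complete f
... | f′ , f′∈ , f′≗f = f′ , ∈-filterᵇ⁺ _ f′∈ (∧-true⁺ (injectiveᵇ⁺ i′) (homᵇ⁺ {H = H} {G} h′)) , f′≗f
  where
  i′ : ∀ {x y} → f′ x ≡ f′ y → x ≡ y
  i′ {x} {y} eq = i (trans (sym (f′≗f x)) (trans eq (f′≗f y)))
  h′ : ∀ {u v} → adj H u v ≡ true → adj G (f′ u) (f′ v) ≡ true
  h′ {u} {v} uv = subst₂ (λ a b → adj G a b ≡ true) (sym (f′≗f u)) (sym (f′≗f v)) (h uv)

embeddings-distinct : (H : Graph t) (G : Graph n) → Distinct (embeddings H G)
embeddings-distinct {t} {n} H G = AllPairsₚ.filter⁺ _ (allMaps-distinct t n)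

homᵇ-mono : {H : Graph t} {G G′ : Graph n} → (∀ u v → adj G u v ≡ true → adj G′ u v ≡ true) →
            ∀ f → homᵇ H G f ≡ true → homᵇ H G′ f ≡ true
homᵇ-mono {H = H} {G} {G′} sub f h = homᵇ⁺ {H = H} {G′} (sub _ _ ∘ homᵇ⁻ {H = H} {G} h)

embeddings-mono : {H : Graph t} {G G′ : Graph n} → (∀ u v → adj G u v ≡ true → adj G′ u v ≡ true) →
                  length (embeddings H G) ≤ length (embeddings H G′)
embeddings-mono {t} {n} {H} {G} {G′} sub =
  length-filterᵇ-mono (λ f h → let i , j = ∧-true⁻ h in ∧-true⁺ i (homᵇ-mono {H = H} {G} {G′} sub f j)) (allMaps t n)

copies-cong : {H : Graph t} {G G′ : Graph n} → (∀ u v → adj G u v ≡ adj G′ u v) → copies H G ≡ copies H G′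
copies-cong {t} {n} {H} {G} {G′} eq = cong (countClasses (sameCopy H)) (filterᵇ-cong
  (λ f → cong (injectiveᵇ f ∧_) (bool-ext
    (homᵇ-mono {H = H} {G} {G′} (λ u v → trans (sym (eq u v))) f)
    (homᵇ-mono {H = H} {G′} {G} (λ u v → trans (eq u v)) f))) (allMaps t n))

⇔ᵇ⁻ : ∀ {p q} → (p ⇔ᵇ q) ≡ true → p ≡ q
⇔ᵇ⁻ {true}  {true}  h = refl
⇔ᵇ⁻ {false} {false} h = refl

⇔ᵇ⁺ : ∀ {p q} → p ≡ q → (p ⇔ᵇ q) ≡ true
⇔ᵇ⁺ {true}  refl = refl
⇔ᵇ⁺ {false} refl = refl

-- One half of `sameCopy`, expressed by preimages: the image of `f` lies in the image of `h`. In
-- this form it passes easily through compositions.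
record SubImage (H : Graph t) (f h : Fin t → Fin n) : Set where
  field
    vertex : ∀ x → ∃[ y ] h y ≡ f x
    edge   : ∀ {a b} → adj H a b ≡ true → ∃[ c ] ∃[ d ] adj H c d ≡ true × h c ≡ f a × h d ≡ f b

open SubImage

inImgE⁻ : (H : Graph t) (f : Fin t → Fin n) {u v : Fin n} → inImgE H f u v ≡ true →
          ∃[ a ] ∃[ b ] adj H a b ≡ true × f a ≡ u × f b ≡ v
inImgE⁻ H f h with adj⁻ {G = map (λ e → f (proj₁ e) , f (proj₂ e)) H} h
... | inj₁ uv∈ with (a , b) , ab∈ , refl ← ∈-map⁻ _ uv∈ = a , b , adj⁺ ab∈ , refl , refl
... | inj₂ vu∈ with (a , b) , ab∈ , refl ← ∈-map⁻ _ vu∈ = b , a , adj⁺′ ab∈ , refl , refl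

inImgE⁺ : (H : Graph t) (f : Fin t → Fin n) {a b : Fin t} → adj H a b ≡ true → inImgE H f (f a) (f b) ≡ true
inImgE⁺ H f ab with adj⁻ {G = H} ab
... | inj₁ e = adj⁺ (∈-map⁺ _ e)
... | inj₂ e = adj⁺′ (∈-map⁺ _ e)

sameCopy⁻ : (H : Graph t) (f h : Fin t → Fin n) → sameCopy H f h ≡ true →
            (∀ v → inImgV f v ≡ inImgV h v) × (∀ u v → inImgE H f u v ≡ inImgE H h u v)
sameCopy⁻ H f h s = let vs , es = ∧-true⁻ s in (λ v → ⇔ᵇ⁻ (allB⁻ vs v)) , (λ u v → ⇔ᵇ⁻ (allB⁻ (allB⁻ es u) v))

sameCopy⁺ : (H : Graph t) (f h : Fin t → Fin n) →
            (∀ v → inImgV f v ≡ inImgV h v) → (∀ u v → inImgE H f u v ≡ inImgE H h u v) → sameCopy H f h ≡ true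
sameCopy⁺ H f h vs es = ∧-true⁺ (allB⁺ (⇔ᵇ⁺ ∘ vs)) (allB⁺ (λ u → allB⁺ (⇔ᵇ⁺ ∘ es u)))

sameCopy-refl : (H : Graph t) (f : Fin t → Fin n) → sameCopy H f f ≡ true
sameCopy-refl H f = sameCopy⁺ H f f (λ _ → refl) (λ _ _ → refl)

sameCopy-sym : (H : Graph t) (f h : Fin t → Fin n) → sameCopy H f h ≡ true → sameCopy H h f ≡ true
sameCopy-sym H f h s = let vs , es = sameCopy⁻ H f h s in sameCopy⁺ H h f (sym ∘ vs) (λ u v → sym (es u v))

sameCopy-trans : (H : Graph t) (f h j : Fin t → Fin n) → sameCopy H f h ≡ true → sameCopy H h j ≡ true → sameCopy H f j ≡ true
sameCopy-trans H f h j s s′ =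
  let vs , es = sameCopy⁻ H f h s ; vs′ , es′ = sameCopy⁻ H h j s′ in
  sameCopy⁺ H f j (λ v → trans (vs v) (vs′ v)) (λ u v → trans (es u v) (es′ u v))

sameCopy⇒SubImage : (H : Graph t) (f h : Fin t → Fin n) → sameCopy H f h ≡ true → SubImage H f h
sameCopy⇒SubImage H f h s = record
  { vertex = λ x → let y , p = anyB⁻ (trans (sym (proj₁ ss (f x))) (anyB⁺ {x = x} (=ᶠ-refl (f x)))) in y , =ᶠ⇒≡ p
  ; edge   = λ ab → inImgE⁻ H h (trans (sym (proj₂ ss _ _)) (inImgE⁺ H f ab))
  }
  where ss = sameCopy⁻ H f h s

SubImage⇒sameCopy : {H : Graph t} {f h : Fin t → Fin n} → SubImage H f h → SubImage H h f → sameCopy H f h ≡ true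
SubImage⇒sameCopy {t} {n} {H} {f} {h} s s′ =
  sameCopy⁺ H f h (λ v → bool-ext (vs s v) (vs s′ v)) (λ u v → bool-ext (es s u v) (es s′ u v))
  where
  vs : {f h : Fin t → Fin n} → SubImage H f h → ∀ v → inImgV f v ≡ true → inImgV h v ≡ true
  vs s v p with x , fx≡v ← anyB⁻ p with y , hy≡ ← vertex s x =
    anyB⁺ {x = y} (≡⇒=ᶠ (trans hy≡ (=ᶠ⇒≡ fx≡v)))
  es : {f h : Fin t → Fin n} → SubImage H f h → ∀ u v → inImgE H f u v ≡ true → inImgE H h u v ≡ true
  es {f} {h} s u v p with a , b , ab , refl , refl ← inImgE⁻ H f p with c , d , cd , c≡ , d≡ ← edge s ab =
    subst₂ (λ u v → inImgE H h u v ≡ true) c≡ d≡ (inImgE⁺ H h cd)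

-- The order of the automorphism group, written as the class of the identity so that it is a class
-- of the same kind as those in `copyClass-size`.
aut : Graph t → ℕ
aut H = length (filterᵇ (sameCopy H id) (embeddings H H))

∈-copyClass⁺ : {H : Graph t} {G : Graph n} {f h : Fin t → Fin n} → IsEmbedding H G h → SubImage H f h → SubImage H h f →
               ∃[ h′ ] h′ ∈ filterᵇ (sameCopy H f) (embeddings H G) × h′ ≗ h
∈-copyClass⁺ {H = H} {G} {f} {h} emb s s′ with h′ , h′∈ , h′≗ ← ∈-embeddings⁺ {H = H} {G} emb =
  h′ , ∈-filterᵇ⁺ _ h′∈ (SubImage⇒sameCopy sub sub′) , h′≗
  where
  sub : SubImage H f h′
  sub = record
    { vertex = λ x → let y , p = vertex s x in y , trans (h′≗ y) p
    ; edge   = λ ab → let c , d , cd , p , q = edge s ab in c , d , cd , trans (h′≗ c) p , trans (h′≗ d) q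
    }
  sub′ : SubImage H h′ f
  sub′ = record
    { vertex = λ x → let y , p = vertex s′ x in y , trans p (sym (h′≗ x))
    ; edge   = λ {a} {b} ab → let c , d , cd , p , q = edge s′ ab in c , d , cd , trans p (sym (h′≗ a)) , trans q (sym (h′≗ b))
    }

∈-copyClass⁻ : {H : Graph t} {G : Graph n} {f h : Fin t → Fin n} → h ∈ filterᵇ (sameCopy H f) (embeddings H G) →
               IsEmbedding H G h × SubImage H f h × SubImage H h f
∈-copyClass⁻ {H = H} {G} {f} {h} h∈ with h∈e , s ← ∈-filterᵇ⁻ _ (embeddings H G) h∈ =
  ∈-embeddings⁻ {H = H} {G} h∈e , sameCopy⇒SubImage H f h s , sameCopy⇒SubImage H h f (sameCopy-sym H f h s)

aut≥1 : (H : Graph t) → 1 ≤ aut H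
aut≥1 H = ∈⇒length≥1 (proj₁ (proj₂ (∈-copyClass⁺ {H = H} {H} {id} {id} (id , id) refl-sub refl-sub)))
  where
  refl-sub : SubImage H id id
  refl-sub = record { vertex = λ x → x , refl ; edge = λ ab → _ , _ , ab , refl , refl }
  ∈⇒length≥1 : {x : A} {xs : List A} → x ∈ xs → 1 ≤ length xs
  ∈⇒length≥1 (here _)  = s≤s z≤n
  ∈⇒length≥1 (there _) = s≤s z≤n

-- Composition with `f` matches automorphisms with the embeddings that have the image of `f`: such
-- an `h` factors through `f`, and the two inclusions of images make the factor `σ` an automorphism.
copyClass-size : (H : Graph t) (G : Graph n) (f : Fin t → Fin n) → IsEmbedding H G f →
                 length (filterᵇ (sameCopy H f) (embeddings H G)) ≡ aut H
copyClass-size {t} {n} H G f (f-inj , f-hom) = ≤-antisym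
  (match-length≤ (λ h σ → f ∘ σ ≗ h) (AllPairsₚ.filter⁺ _ (embeddings-distinct H G)) shrink
    (λ h≇h′ p q → h≇h′ (λ x → trans (sym (p x)) (q x))))
  (match-length≤ (λ σ h → f ∘ σ ≗ h) (AllPairsₚ.filter⁺ _ (embeddings-distinct H H)) expand
    (λ σ≇σ′ p q → σ≇σ′ (λ x → f-inj (trans (p x) (sym (q x))))))
  where
  expand : ∀ {σ} → σ ∈ filterᵇ (sameCopy H id) (embeddings H H) →
           ∃[ h ] h ∈ filterᵇ (sameCopy H f) (embeddings H G) × f ∘ σ ≗ h
  expand {σ} σ∈ with (σ-inj , σ-hom) , s , s′ ← ∈-copyClass⁻ {H = H} {H} σ∈
    with h , h∈ , h≗ ← ∈-copyClass⁺ {H = H} {G} {f} {f ∘ σ} (σ-inj ∘ f-inj , f-hom ∘ σ-hom)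
      (record { vertex = λ x → let y , p = vertex s x in y , cong f p
              ; edge = λ ab → let c , d , cd , p , q = edge s ab in c , d , cd , cong f p , cong f q })
      (record { vertex = λ x → σ x , refl ; edge = λ ab → _ , _ , σ-hom ab , refl , refl })
    = h , h∈ , sym ∘ h≗
  shrink : ∀ {h} → h ∈ filterᵇ (sameCopy H f) (embeddings H G) →
           ∃[ σ ] σ ∈ filterᵇ (sameCopy H id) (embeddings H H) × f ∘ σ ≗ h
  shrink {h} h∈ with (h-inj , h-hom) , s , s′ ← ∈-copyClass⁻ {H = H} {G} h∈ = 
    let σ′ , σ′∈ , σ′≗ = ∈-copyClass⁺ {H = H} {H} {id} {σ} (σ-inj , σ-hom)
          (record { vertex = λ x → let y , p = vertex s x in y , f-inj (trans (fσ y) p)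
                  ; edge = λ ab → let c , d , cd , p , q = edge s ab in
                      c , d , cd , f-inj (trans (fσ c) p) , f-inj (trans (fσ d) q) })
          (record { vertex = λ x → σ x , refl ; edge = λ ab → _ , _ , σ-hom ab , refl , refl })
    in σ′ , σ′∈ , λ x → trans (cong f (σ′≗ x)) (fσ x)
    where
    σ : Fin t → Fin t
    σ x = proj₁ (vertex s′ x)
    fσ : ∀ x → f (σ x) ≡ h x
    fσ x = proj₂ (vertex s′ x)
    σ-inj : ∀ {x y} → σ x ≡ σ y → x ≡ y
    σ-inj {x} {y} eq = h-inj (trans (sym (fσ x)) (trans (cong f eq) (fσ y)))
    σ-hom : ∀ {u v} → adj H u v ≡ true → adj H (σ u) (σ v) ≡ true
    σ-hom {u} {v} uv with c , d , cd , p , q ← edge s′ uv =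
      subst₂ (λ a b → adj H a b ≡ true) (f-inj (trans p (sym (fσ u)))) (f-inj (trans q (sym (fσ v)))) cd

-- Counting the classes of an equivalence relation

module ClassCounting (eq : A → A → Bool)
  (eq-refl : ∀ x → eq x x ≡ true)
  (eq-sym : ∀ x y → eq x y ≡ true → eq y x ≡ true)
  (eq-trans : ∀ x y z → eq x y ≡ true → eq y z ≡ true → eq x z ≡ true) where

  -- The elements at which `countClasses` increases: the last member of each class.
  representatives : List A → List A
  representatives []       = []
  representatives (x ∷ xs) = if any (eq x) xs then representatives xs else x ∷ representatives xs

  representatives-⊆ : ∀ xs {r} → r ∈ representatives xs → r ∈ xs
  representatives-⊆ (x ∷ xs) r∈ with any (eq x) xs
  representatives-⊆ (x ∷ xs) r∈          | true  = there (representatives-⊆ xs r∈)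
  representatives-⊆ (x ∷ xs) (here refl) | false = here refl
  representatives-⊆ (x ∷ xs) (there r∈)  | false = there (representatives-⊆ xs r∈)

  countClasses-representatives : ∀ xs → countClasses eq xs ≡ length (representatives xs)
  countClasses-representatives []       = refl
  countClasses-representatives (x ∷ xs) with any (eq x) xs
  ... | true  = countClasses-representatives xs
  ... | false = cong suc (countClasses-representatives xs)

  any-related : ∀ x y xs → eq x y ≡ true → any (eq x) xs ≡ true → any (eq y) xs ≡ true
  any-related x y xs xy h with z , z∈ , xz ← any-true⁻ (eq x) xs h =
    any-true⁺ (eq y) z∈ (eq-trans y x z (eq-sym x y xy) xz)

  -- Induction along the list: a new head becomes a representative exactly when its class is absent
  -- from the tail, so no class gains a second one.
  representative-unique : ∀ x xs → length (filterᵇ (λ r → eq r x) (representatives xs)) ≡ χ (any (eq x) xs)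
  representative-unique x []       = refl
  representative-unique x (y ∷ xs) with any (eq y) xs in any-y | eq x y in xy
  ... | true  | true  = trans (representative-unique x xs) (cong χ (any-related y x xs (eq-sym x y xy) any-y))
  ... | true  | false = representative-unique x xs
  ... | false | xy? with eq y x in yx | xy?
  ...   | true  | true  = cong suc (trans (representative-unique x xs) (cong χ
                            (≢true⇒false (λ h → true≢false (any-related x y xs xy h) any-y))))
  ...   | true  | false = ⊥-elim (true≢false (eq-sym y x yx) xy)
  ...   | false | true  = ⊥-elim (true≢false (eq-sym x y xy) yx)
  ...   | false | false = representative-unique x xs

  classSizes : List A → List A → ℕ
  classSizes []       xs = 0
  classSizes (r ∷ rs) xs = length (filterᵇ (eq r) xs) + classSizes rs xs

  classSizes-∷ : ∀ rs x xs → classSizes rs (x ∷ xs) ≡ length (filterᵇ (λ r → eq r x) rs) + classSizes rs xs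
  classSizes-∷ []       x xs = refl
  classSizes-∷ (r ∷ rs) x xs with eq r x
  ... | true  = trans (cong (suc (length (filterᵇ (eq r) xs)) +_) (classSizes-∷ rs x xs))
                      (rearrange (length (filterᵇ (eq r) xs)) (length (filterᵇ (λ r → eq r x) rs)) (classSizes rs xs))
    where
    rearrange : ∀ a b c → suc a + (b + c) ≡ suc b + (a + c)
    rearrange = solve-∀
  ... | false = trans (cong (length (filterᵇ (eq r) xs) +_) (classSizes-∷ rs x xs))
                      (rearrange (length (filterᵇ (eq r) xs)) (length (filterᵇ (λ r → eq r x) rs)) (classSizes rs xs))
    where
    rearrange : ∀ a b c → a + (b + c) ≡ b + (a + c)
    rearrange = solve-∀

  no-related : ∀ x xs → any (eq x) xs ≡ false → length (filterᵇ (eq x) xs) ≡ 0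
  no-related x []       h = refl
  no-related x (y ∷ xs) h with eq x y
  ... | false = no-related x xs h

  -- Double counting of the pairs of a representative and an element of its class: by
  -- `representative-unique`, every element belongs to exactly one pair.
  classSizes-representatives : ∀ xs → classSizes (representatives xs) xs ≡ length xs
  classSizes-representatives []       = refl
  classSizes-representatives (x ∷ xs) with any (eq x) xs in any-x
  ... | true = trans (classSizes-∷ (representatives xs) x xs)
      (cong₂ _+_ (trans (representative-unique x xs) (cong χ any-x)) (classSizes-representatives xs))
  ... | false rewrite eq-refl x | no-related x xs any-x = cong suc (trans (classSizes-∷ (representatives xs) x xs)
      (cong₂ _+_ (trans (representative-unique x xs) (cong χ any-x)) (classSizes-representatives xs)))

  classSizes-const : ∀ s rs xs → (∀ {r} → r ∈ rs → length (filterᵇ (eq r) xs) ≡ s) → classSizes rs xs ≡ length rs * s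
  classSizes-const s []       xs h = refl
  classSizes-const s (r ∷ rs) xs h = cong₂ _+_ (h (here refl)) (classSizes-const s rs xs (h ∘ there))

  length≡countClasses* : ∀ s xs → (∀ {x} → x ∈ xs → length (filterᵇ (eq x) xs) ≡ s) → length xs ≡ countClasses eq xs * s
  length≡countClasses* s xs h = trans (sym (classSizes-representatives xs))
    (trans (classSizes-const s (representatives xs) xs (h ∘ representatives-⊆ xs))
           (cong (_* s) (sym (countClasses-representatives xs))))

embeddings≡copies*aut : (H : Graph t) (G : Graph n) → length (embeddings H G) ≡ copies H G * aut H
embeddings≡copies*aut H G = ClassCounting.length≡countClasses* (sameCopy H) (sameCopy-refl H) (sameCopy-sym H) (sameCopy-trans H)
  (aut H) (embeddings H G) (λ {f} f∈ → copyClass-size H G f (∈-embeddings⁻ {H = H} {G} f∈))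

-- Freeness, and star-freeness as a degree bound

∈⇒length≢0 : {x : A} {xs : List A} → x ∈ xs → length xs ≢ 0
∈⇒length≢0 (here _)  ()
∈⇒length≢0 (there _) ()

∄∈⇒[] : (xs : List A) → (∀ x → x ∉ xs) → xs ≡ []
∄∈⇒[] []       h = refl
∄∈⇒[] (x ∷ xs) h = contradiction (here refl) (h x)

free⁻ : (H : Graph t) (G : Graph n) {f : Fin t → Fin n} → freeᵇ H G ≡ true → IsEmbedding H G f → ⊥
free⁻ H G free emb = ∈⇒length≢0 (proj₁ (proj₂ (∈-embeddings⁺ {H = H} {G} emb)))
  (trans (embeddings≡copies*aut H G) (cong (_* aut H) (≡ᵇ⇒≡ (copies H G) 0 (Equivalence.from T-≡ free))))

free⁺ : (H : Graph t) (G : Graph n) → (∀ f → ¬ IsEmbedding H G f) → freeᵇ H G ≡ true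
free⁺ H G h = Equivalence.to T-≡ (≡⇒≡ᵇ (copies H G) 0 (cong (countClasses (sameCopy H))
  (∄∈⇒[] (embeddings H G) (λ f f∈ → h f (∈-embeddings⁻ {H = H} {G} f∈)))))

nbrs : Graph n → Fin n → List (Fin n)
nbrs {n} G v = filterᵇ (adj G v) (allFin n)

-- Neighbours are counted through `adj`, so repeated entries of the edge list do not matter.
degree : Graph n → Fin n → ℕ
degree G v = length (nbrs G v)

nbrs-unique : (G : Graph n) (v : Fin n) → Unique (nbrs G v)
nbrs-unique {n} G v = filterᵇ-unique _ (Uniqueₚ.allFin⁺ n)

∈-nbrs⁺ : {G : Graph n} {v w : Fin n} → adj G v w ≡ true → w ∈ nbrs G v
∈-nbrs⁺ {w = w} = ∈-filterᵇ⁺ _ (∈-allFin w)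

∈-nbrs⁻ : {G : Graph n} {v w : Fin n} → w ∈ nbrs G v → adj G v w ≡ true
∈-nbrs⁻ {n} w∈ = proj₂ (∈-filterᵇ⁻ _ (allFin n) w∈)

Unique⇒lookup-injective : {xs : List A} → Unique xs → ∀ i j → lookup xs i ≡ lookup xs j → i ≡ j
Unique⇒lookup-injective (_  ∷ _) zero    zero    eq = refl
Unique⇒lookup-injective (x∉ ∷ _) zero    (suc j) eq = contradiction eq (All.lookup x∉ (∈-lookup j))
Unique⇒lookup-injective (x∉ ∷ _) (suc i) zero    eq = contradiction (sym eq) (All.lookup x∉ (∈-lookup i))
Unique⇒lookup-injective (_  ∷ u) (suc i) (suc j) eq = cong suc (Unique⇒lookup-injective u i j eq)

star⁻ : ∀ l {u v} → (u , v) ∈ star l → u ≡ zero × ∃[ i ] v ≡ suc i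
star⁻ l e∈ with i , _ , refl ← ∈-map⁻ _ e∈ = refl , i , refl

degree≤⇒star-free : {G : Graph n} {k : ℕ} → (∀ v → degree G v ≤ k) → freeᵇ (star (suc k)) G ≡ true
degree≤⇒star-free {n} {G} {k} h = free⁺ (star (suc k)) G contra
  where
  contra : (f : Fin (suc (suc k)) → Fin n) → ¬ IsEmbedding (star (suc k)) G f
  contra f (inj , hom) = <⇒≱ (s≤s (h (f zero))) (subst (_≤ degree G (f zero))
    (trans (length-map (f ∘ suc) (allFin (suc k))) (length-tabulate {n = suc k} id))
    (Unique-⊆⇒length≤ (Unique-map (f ∘ suc) (λ _ _ eq → Finₚ.suc-injective (inj eq)) (Uniqueₚ.allFin⁺ (suc k)))
      (λ x∈ → leaf (∈-map⁻ _ x∈))))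
    where
    leaf : ∀ {x} → ∃[ i ] i ∈ allFin (suc k) × x ≡ f (suc i) → x ∈ nbrs G (f zero)
    leaf (i , _ , refl) = ∈-nbrs⁺ {G = G} (hom (adj⁺ {G = star (suc k)} (∈-map⁺ _ (∈-allFin i))))

-- The leaves are the first `suc k` neighbours of a vertex of too large degree; without loops none
-- of them is the centre.
star-free⇒degree≤ : {G : Graph n} {k : ℕ} → (∀ v → adj G v v ≡ false) → freeᵇ (star (suc k)) G ≡ true →
                    ∀ v → degree G v ≤ k
star-free⇒degree≤ {n} {G} {k} loopless free v with degree G v ≤? k
... | yes p = p
... | no ¬p = ⊥-elim (free⁻ (star (suc k)) G {f} free ((λ {x} {y} → inj x y) , hom))
  where
  nth : Fin (suc k) → Fin n
  nth i = lookup (nbrs G v) (inject≤ i (≰⇒> ¬p))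
  nth-adj : ∀ i → adj G v (nth i) ≡ true
  nth-adj i = ∈-nbrs⁻ {G = G} (∈-lookup (inject≤ i (≰⇒> ¬p)))
  f : Fin (suc (suc k)) → Fin n
  f zero    = v
  f (suc i) = nth i
  v≢nth : ∀ i → v ≡ nth i → ⊥
  v≢nth i eq = true≢false (subst (λ w → adj G v w ≡ true) (sym eq) (nth-adj i)) (loopless v)
  inj : ∀ x y → f x ≡ f y → x ≡ y
  inj zero    zero    eq = refl
  inj zero    (suc j) eq = ⊥-elim (v≢nth j eq)
  inj (suc i) zero    eq = ⊥-elim (v≢nth i (sym eq))
  inj (suc i) (suc j) eq = cong suc (Finₚ.inject≤-injective _ _ i j (Unique⇒lookup-injective (nbrs-unique G v) _ _ eq))
  hom : ∀ {a b} → adj (star (suc k)) a b ≡ true → adj G (f a) (f b) ≡ true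
  hom ab with adj⁻ {G = star (suc k)} ab
  ... | inj₁ e with refl , i , refl ← star⁻ (suc k) e = nth-adj i
  ... | inj₂ e with refl , i , refl ← star⁻ (suc k) e = adj-sym⁺ {G = G} (nth-adj i)

-- Quadratic forms of adjacency matrices

χ≤1 : ∀ p → χ p ≤ 1
χ≤1 true  = ≤-refl
χ≤1 false = z≤n

χ-∧ : ∀ p q → χ (p ∧ q) ≡ χ p * χ q
χ-∧ true  true  = refl
χ-∧ true  false = refl
χ-∧ false q     = refl

χ-∨ : ∀ p q → χ (p ∨ q) ≤ χ p + χ q
χ-∨ true  q = s≤s z≤n
χ-∨ false q = ≤-refl

χ-∨-disjoint : ∀ p q → (p ≡ true → q ≡ true → ⊥) → χ (p ∨ q) ≡ χ p + χ q
χ-∨-disjoint true  true  h = ⊥-elim (h refl refl)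
χ-∨-disjoint true  false h = refl
χ-∨-disjoint false q     h = refl

χ≢0 : ∀ {p} → χ p ≢ 0 → p ≡ true
χ≢0 {true}  h = refl
χ≢0 {false} h = contradiction refl h

χ-true : ∀ {p} → p ≡ true → χ p ≡ 1
χ-true refl = refl

χ-false : ∀ {p} → p ≡ false → χ p ≡ 0
χ-false refl = refl

opaque
  ∑ : (Fin n → ℕ) → ℕ
  ∑ = sum

  ∑-suc : (u : Fin (suc n) → ℕ) → ∑ u ≡ u zero + ∑ (u ∘ suc)
  ∑-suc u = refl

  ∑-cong : {u v : Fin n → ℕ} → (∀ i → u i ≡ v i) → ∑ u ≡ ∑ v
  ∑-cong = sum-cong-≗

  ∑-+ : (u v : Fin n → ℕ) → ∑ (λ i → u i + v i) ≡ ∑ u + ∑ v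
  ∑-+ = ∑-distrib-+

  ∑-swap : (M : Fin m → Fin n → ℕ) → ∑ (λ i → ∑ (M i)) ≡ ∑ (λ j → ∑ (λ i → M i j))
  ∑-swap = ∑-comm

  *-distribˡ-∑ : (c : ℕ) (u : Fin n → ℕ) → c * ∑ u ≡ ∑ (λ i → c * u i)
  *-distribˡ-∑ = *-distribˡ-sum

  *-distribʳ-∑ : (c : ℕ) (u : Fin n → ℕ) → ∑ u * c ≡ ∑ (λ i → u i * c)
  *-distribʳ-∑ = *-distribʳ-sum

  ∑-mono : {u v : Fin n → ℕ} → (∀ i → u i ≤ v i) → ∑ u ≤ ∑ v
  ∑-mono {zero}  h = z≤n
  ∑-mono {suc n} h = +-mono-≤ (h zero) (∑-mono (h ∘ suc))

  ∑-zero : {u : Fin n → ℕ} → (∀ i → u i ≡ 0) → ∑ u ≡ 0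
  ∑-zero {zero}  h = refl
  ∑-zero {suc n} h = cong₂ _+_ (h zero) (∑-zero (h ∘ suc))

  ∑≢0 : {u : Fin n → ℕ} → ∑ u ≢ 0 → ∃[ i ] u i ≢ 0
  ∑≢0 {zero}      h = contradiction refl h
  ∑≢0 {suc n} {u} h with u zero ≟ 0
  ... | no u0≢0  = zero , u0≢0
  ... | yes u0≡0 with i , ui≢0 ← ∑≢0 {n} {u ∘ suc} (λ eq → h (cong₂ _+_ u0≡0 eq)) = suc i , ui≢0

  ≤∑ : (u : Fin n → ℕ) (i : Fin n) → u i ≤ ∑ u
  ≤∑ u zero    = m≤m+n _ _
  ≤∑ u (suc i) = ≤-trans (≤∑ (u ∘ suc) i) (m≤n+m _ (u zero))

  length-filterᵇ-tabulate : (p : A → Bool) (f : Fin n → A) →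
                            length (filterᵇ p (tabulate f)) ≡ ∑ (χ ∘ p ∘ f)
  length-filterᵇ-tabulate {n = zero}  p f = refl
  length-filterᵇ-tabulate {n = suc n} p f with p (f zero)
  ... | true  = cong suc (length-filterᵇ-tabulate p (f ∘ suc))
  ... | false = length-filterᵇ-tabulate p (f ∘ suc)

δ : Fin n → Fin n → ℕ
δ i j = χ (i =ᶠ j)

δ-refl : (i : Fin n) → δ i i ≡ 1
δ-refl i = χ-true (=ᶠ-refl i)

δ-≢ : {i j : Fin n} → i ≢ j → δ i j ≡ 0
δ-≢ = χ-false ∘ ≢⇒=ᶠ-false

δ-suc : (i j : Fin n) → δ (suc i) (suc j) ≡ δ i j
δ-suc i j with i ≟ᶠ j
... | yes _ = refl
... | no  _ = refl

dot : (Fin n → ℕ) → (Fin n → ℕ) → ℕ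
dot u v = ∑ (λ i → u i * v i)

dot-δ : (x : Fin n) (v : Fin n → ℕ) → dot (δ x) v ≡ v x
dot-δ {suc n} zero v = trans (∑-suc _)
  (trans (cong (v zero + 0 +_) (∑-zero (λ _ → refl))) (trans (+-identityʳ _) (+-identityʳ _)))
dot-δ (suc x) v = trans (∑-suc _) (trans (∑-cong (λ i → cong (_* v (suc i)) (δ-suc x i))) (dot-δ x (v ∘ suc)))

dot-comm : (u v : Fin n → ℕ) → dot u v ≡ dot v u
dot-comm u v = ∑-cong (λ i → *-comm (u i) (v i))

dot-+ˡ : (u v w : Fin n → ℕ) → dot (λ i → u i + v i) w ≡ dot u w + dot v w
dot-+ˡ u v w = trans (∑-cong (λ i → *-distribʳ-+ (w i) (u i) (v i))) (∑-+ _ _)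

dot-+ʳ : (u v w : Fin n → ℕ) → dot u (λ i → v i + w i) ≡ dot u v + dot u w
dot-+ʳ u v w = trans (∑-cong (λ i → *-distribˡ-+ (u i) (v i) (w i))) (∑-+ _ _)

dot-mono : {u u′ v v′ : Fin n → ℕ} → (∀ i → u i ≤ u′ i) → (∀ i → v i ≤ v′ i) → dot u v ≤ dot u′ v′
dot-mono hu hv = ∑-mono (λ i → *-mono-≤ (hu i) (hv i))

Matrix : ℕ → Set
Matrix n = Fin n → Fin n → ℕ

app : Matrix n → (Fin n → ℕ) → Fin n → ℕ
app M v i = dot (M i) v

-- Serves two purposes: with an indicator vector it counts the ordered adjacent pairs in a set, and
-- with deficits and Blocker's graph it is the danger.
form : Matrix n → (Fin n → ℕ) → ℕ
form M v = dot v (app M v)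

Symmetric : Matrix n → Set
Symmetric M = ∀ i j → M i j ≡ M j i

app-δ : (M : Matrix n) (y i : Fin n) → app M (δ y) i ≡ M i y
app-δ M y i = trans (dot-comm (M i) (δ y)) (dot-δ y (M i))

dot-app-sym : {M : Matrix n} → Symmetric M → (u v : Fin n → ℕ) → dot u (app M v) ≡ dot v (app M u)
dot-app-sym {M = M} M-sym u v =
  trans (∑-cong (λ i → *-distribˡ-∑ (u i) _))
  (trans (∑-swap (λ i j → u i * (M i j * v j)))
  (∑-cong (λ j → trans (∑-cong (λ i → trans (rearrange (u i) (M i j) (v j)) (cong (λ a → v j * (a * u i)) (M-sym i j))))
                           (sym (*-distribˡ-∑ (v j) _)))))
  where
  rearrange : ∀ a b c → a * (b * c) ≡ c * (b * a)
  rearrange = solve-∀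

-- Polarisation; symmetry merges the two mixed terms.
form-+ : {M : Matrix n} → Symmetric M → (u v : Fin n → ℕ) →
         form M (λ i → u i + v i) ≡ form M u + form M v + 2 * dot u (app M v)
form-+ {M = M} M-sym u v = trans (dot-+ˡ u v _)
  (trans (cong₂ _+_ (trans (split u) (dot-+ʳ u (app M u) (app M v))) (trans (split v) (dot-+ʳ v (app M u) (app M v))))
  (trans (cong (λ a → form M u + dot u (app M v) + (a + form M v)) (dot-app-sym M-sym v u))
         (rearrange (form M u) (dot u (app M v)) (form M v))))
  where
  split : ∀ w → dot w (app M (λ i → u i + v i)) ≡ dot w (λ i → app M u i + app M v i)
  split w = ∑-cong (λ i → cong (w i *_) (dot-+ʳ (M i) u v))
  rearrange : ∀ a b c → a + b + (b + c) ≡ a + c + 2 * b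
  rearrange = solve-∀

form-cong : (M : Matrix n) {u v : Fin n → ℕ} → (∀ i → u i ≡ v i) → form M u ≡ form M v
form-cong M h = ∑-cong (λ i → cong₂ _*_ (h i) (∑-cong (λ j → cong (M i j *_) (h j))))

-- The adjacency matrix of the single edge `xy`, in both orders; for `x ≡ y` the diagonal entry is
-- 2.
pairM : Fin n → Fin n → Matrix n
pairM x y i j = δ x i * δ y j + δ x j * δ y i

app-pairM : (M : Matrix n) (x y : Fin n) (v : Fin n → ℕ) (i : Fin n) →
            app (λ i j → M i j + pairM x y i j) v i ≡ app M v i + (δ x i * v y + δ y i * v x)
app-pairM M x y v i = trans (dot-+ˡ (M i) (pairM x y i) v) (cong (app M v i +_)
  (trans (dot-+ˡ (λ j → δ x i * δ y j) (λ j → δ x j * δ y i) v)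
    (cong₂ _+_ (pull (δ x i) y (λ _ → refl)) (pull (δ y i) x (λ j → *-comm (δ x j) (δ y i))))))
  where
  pull : ∀ c z {w : Fin _ → ℕ} → (∀ j → w j ≡ c * δ z j) → dot w v ≡ c * v z
  pull c z eq = trans (∑-cong (λ j → trans (cong (_* v j) (eq j)) (*-assoc c (δ z j) (v j))))
    (trans (sym (*-distribˡ-∑ c _)) (cong (c *_) (dot-δ z v)))

form-pairM : (M : Matrix n) (x y : Fin n) (v : Fin n → ℕ) →
             form (λ i j → M i j + pairM x y i j) v ≡ form M v + 2 * (v x * v y)
form-pairM M x y v = trans (∑-cong (λ i → cong (v i *_) (app-pairM M x y v i)))
  (trans (dot-+ʳ v (app M v) _) (cong (form M v +_)
    (trans (dot-+ʳ v (λ i → δ x i * v y) (λ i → δ y i * v x))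
      (trans (cong₂ _+_ (pull x (v y)) (pull y (v x))) (rearrange (v x) (v y))))))
  where
  pull : ∀ z c → dot v (λ i → δ z i * c) ≡ v z * c
  pull z c = trans (∑-cong (λ i → swap (v i) (δ z i) c)) (trans (sym (*-distribʳ-∑ c _)) (cong (_* c) (dot-δ z v)))
    where
    swap : ∀ a b c → a * (b * c) ≡ b * a * c
    swap = solve-∀
  rearrange : ∀ a b → a * b + b * a ≡ 2 * (a * b)
  rearrange = solve-∀

form-mono : {M M′ : Matrix n} → (∀ i j → M i j ≤ M′ i j) → (v : Fin n → ℕ) → form M v ≤ form M′ v
form-mono h v = dot-mono {u = v} (λ _ → ≤-refl) (λ i → dot-mono {v = v} (h i) (λ _ → ≤-refl))

adjM : Graph n → Matrix n
adjM G i j = χ (adj G i j)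

adjM-sym : (G : Graph n) → Symmetric (adjM G)
adjM-sym G i j = cong χ (adj-sym G i j)

χ-pair : (x y i j : Fin n) → χ (((x =ᶠ i) ∧ (y =ᶠ j)) ∨ ((x =ᶠ j) ∧ (y =ᶠ i))) ≤ pairM x y i j
χ-pair x y i j = ≤-trans (χ-∨ ((x =ᶠ i) ∧ (y =ᶠ j)) _) (≤-reflexive (cong₂ _+_ (χ-∧ (x =ᶠ i) _) (χ-∧ (x =ᶠ j) _)))

-- An inequality, so that it holds even for a loop or for an edge already present.
adjM-∷≤ : (G : Graph n) (x y i j : Fin n) → adjM ((x , y) ∷ G) i j ≤ adjM G i j + pairM x y i j
adjM-∷≤ G x y i j = ≤-trans (χ-∨ (((x =ᶠ i) ∧ (y =ᶠ j)) ∨ ((x =ᶠ j) ∧ (y =ᶠ i))) _)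
  (≤-trans (+-monoˡ-≤ _ (χ-pair x y i j)) (≤-reflexive (+-comm (pairM x y i j) _)))

adjM-∷ : (G : Graph n) {x y : Fin n} → x ≢ y → adj G x y ≡ false → ∀ i j →
         adjM ((x , y) ∷ G) i j ≡ adjM G i j + pairM x y i j
adjM-∷ G {x} {y} x≢y xy∉ i j =
  trans (χ-∨-disjoint (((x =ᶠ i) ∧ (y =ᶠ j)) ∨ ((x =ᶠ j) ∧ (y =ᶠ i))) (adj G i j) old)
  (trans (cong (_+ adjM G i j) (trans (χ-∨-disjoint ((x =ᶠ i) ∧ (y =ᶠ j)) ((x =ᶠ j) ∧ (y =ᶠ i)) loop)
                                      (cong₂ _+_ (χ-∧ (x =ᶠ i) _) (χ-∧ (x =ᶠ j) _))))
         (+-comm (pairM x y i j) _))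
  where
  both : ∀ {a b} → (x =ᶠ a) ∧ (y =ᶠ b) ≡ true → x ≡ a × y ≡ b
  both h = let p , q = ∧-true⁻ h in =ᶠ⇒≡ p , =ᶠ⇒≡ q
  loop : (x =ᶠ i) ∧ (y =ᶠ j) ≡ true → (x =ᶠ j) ∧ (y =ᶠ i) ≡ true → ⊥
  loop h h′ = x≢y (trans (proj₁ (both h)) (sym (proj₂ (both h′))))
  old : ((x =ᶠ i) ∧ (y =ᶠ j)) ∨ ((x =ᶠ j) ∧ (y =ᶠ i)) ≡ true → adj G i j ≡ true → ⊥
  old h ij with ∨-true⁻ h
  ... | inj₁ p with refl , refl ← both p = true≢false ij xy∉
  ... | inj₂ p with refl , refl ← both p = true≢false (adj-sym⁺ {G = G} ij) xy∉

degree≡∑ : (G : Graph n) (v : Fin n) → degree G v ≡ ∑ (adjM G v)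
degree≡∑ G v = length-filterᵇ-tabulate (adj G v) id

-- A degree is a row sum, hence the matrix applied to the constant vector 1, and `app-pairM`
-- computes the change.
degree-∷ : (G : Graph n) {x y : Fin n} → x ≢ y → adj G x y ≡ false → ∀ v →
           degree ((x , y) ∷ G) v ≡ degree G v + (δ x v + δ y v)
degree-∷ G {x} {y} x≢y xy∉ v = begin
  degree ((x , y) ∷ G) v                               ≡⟨ degree≡∑ ((x , y) ∷ G) v ⟩
  ∑ (adjM ((x , y) ∷ G) v)                           ≡⟨ ∑-cong (λ j → trans (adjM-∷ G x≢y xy∉ v j) (sym (*-identityʳ _))) ⟩
  app (λ i j → adjM G i j + pairM x y i j) (λ _ → 1) v ≡⟨ app-pairM (adjM G) x y (λ _ → 1) v ⟩
  app (adjM G) (λ _ → 1) v + (δ x v * 1 + δ y v * 1)   ≡⟨ cong₂ _+_ (∑-cong (λ j → *-identityʳ (adjM G v j))) (cong₂ _+_ (*-identityʳ (δ x v)) (*-identityʳ (δ y v))) ⟩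
  ∑ (adjM G v) + (δ x v + δ y v)                     ≡⟨ cong (_+ (δ x v + δ y v)) (sym (degree≡∑ G v)) ⟩
  degree G v + (δ x v + δ y v)                         ∎
  where open ≡-Reasoning

-- Balls and sparse graphs

ball : Graph n → ℕ → Fin n → Fin n → Bool
ball G zero    x y = x =ᶠ y
ball G (suc j) x y = ball G j x y ∨ anyB (λ z → ball G j x z ∧ adj G z y)

ball-step : (G : Graph n) (j : ℕ) {x y z : Fin n} → ball G j x z ≡ true → adj G z y ≡ true → ball G (suc j) x y ≡ true
ball-step G j {z = z} xz zy = ∨-true⁺ʳ _ (anyB⁺ {x = z} (∧-true⁺ xz zy))

ball-mono : (G : Graph n) {i j : ℕ} → i ≤′ j → {x y : Fin n} → ball G i x y ≡ true → ball G j x y ≡ true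
ball-mono G ≤′-refl       h = h
ball-mono G (≤′-step i≤j) h = ∨-true⁺ˡ (ball-mono G i≤j h)

ball-refl : (G : Graph n) (j : ℕ) (x : Fin n) → ball G j x x ≡ true
ball-refl G zero    x = =ᶠ-refl x
ball-refl G (suc j) x = ∨-true⁺ˡ (ball-refl G j x)

ball-prefix : (G : Graph n) (j : ℕ) {x y z : Fin n} → adj G x z ≡ true → ball G j z y ≡ true → ball G (suc j) x y ≡ true
ball-prefix G zero {x} xz zy with refl ← =ᶠ⇒≡ zy = ball-step G zero (=ᶠ-refl x) xz
ball-prefix G (suc j) {x} {y} {z} xz zy with ∨-true⁻ zy
... | inj₁ p = ∨-true⁺ˡ (ball-prefix G j xz p)
... | inj₂ p with w , q ← anyB⁻ {p = λ w → ball G j z w ∧ adj G w y} p = let zw , wy = ∧-true⁻ q in ball-step G (suc j) (ball-prefix G j xz zw) wy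

-- A larger ball gains at most the neighbours of the members of the previous one, so each step
-- multiplies the size by at most `suc k`.
ball-size : (G : Graph n) {k : ℕ} → (∀ v → degree G v ≤ k) → ∀ j x → ∑ (χ ∘ ball G j x) ≤ suc k ^ j
ball-size G h zero x = ≤-reflexive
  (trans (∑-cong (λ i → sym (*-identityʳ (δ x i)))) (dot-δ x (λ _ → 1)))
ball-size {n} G {k} h (suc j) x = begin
  ∑ (λ y → χ (ball G (suc j) x y))            ≤⟨ ∑-mono grow ⟩
  ∑ (λ y → b y + app (adjM G) b y)            ≡⟨ ∑-+ b _ ⟩
  -- By symmetry, the adjacent pairs are counted from inside the ball, where the degree bound
  -- applies.
  ∑ b + ∑ (app (adjM G) b)                  ≡⟨ cong (∑ b +_) (trans (∑-cong (λ i → sym (*-identityˡ _))) (dot-app-sym (adjM-sym G) (λ _ → 1) b)) ⟩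
  ∑ b + dot b (app (adjM G) (λ _ → 1))        ≤⟨ +-monoʳ-≤ (∑ b) (dot-mono {u = b} (λ _ → ≤-refl) deg≤) ⟩
  ∑ b + dot b (λ _ → k)                       ≡⟨ cong (∑ b +_) (sym (*-distribʳ-∑ k b)) ⟩
  ∑ b + ∑ b * k                             ≡⟨ sym (*-suc (∑ b) k) ⟩
  ∑ b * suc k                                 ≤⟨ *-monoˡ-≤ (suc k) (ball-size G h j x) ⟩
  suc k ^ j * suc k                             ≡⟨ *-comm (suc k ^ j) (suc k) ⟩
  suc k ^ suc j                                 ∎
  where
  open ≤-Reasoning
  b : Fin n → ℕ
  b y = χ (ball G j x y)
  deg≤ : ∀ i → app (adjM G) (λ _ → 1) i ≤ k
  deg≤ i = ≤-trans (≤-reflexive (trans (∑-cong (λ j → *-identityʳ (adjM G i j))) (sym (degree≡∑ G i)))) (h i)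
  grow : ∀ y → χ (ball G (suc j) x y) ≤ b y + app (adjM G) b y
  grow y = ≤-trans (χ-∨ (ball G j x y) _) (+-monoʳ-≤ (b y) reach)
    where
    reach : χ (anyB (λ z → ball G j x z ∧ adj G z y)) ≤ app (adjM G) b y
    reach with anyB (λ z → ball G j x z ∧ adj G z y) in eq
    ... | false = z≤n
    ... | true with z , p ← anyB⁻ eq = let xz , zy = ∧-true⁻ p in
      ≤-trans (≤-reflexive (sym (cong₂ _*_ (χ-true (adj-sym⁺ {G = G} zy)) (χ-true xz)))) (≤∑ (λ i → adjM G y i * b i) z)

-- Every nonempty set of at most t vertices spans fewer edges than it has vertices, i.e. G has girth above t;
-- s is the indicator of the set, and the form counts ordered pairs.
Sparse : ℕ → Graph n → Set
Sparse {n} t G = (s : Fin n → ℕ) → (∀ i → s i ≤ 1) → 1 ≤ ∑ s → ∑ s ≤ t → form (adjM G) s + 2 ≤ 2 * ∑ s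

-- The intended `inner` is the component of `x` in the subgraph induced on `s`. Only its separation
-- from the rest and its small radius are kept.
record Closure (G : Graph n) (t : ℕ) (s : Fin n → ℕ) (x : Fin n) : Set where
  field
    inner outer : Fin n → ℕ
    split       : ∀ i → s i ≡ inner i + outer i
    root        : 1 ≤ inner x
    near        : ∀ i → inner i ≢ 0 → ball G t x i ≡ true
    separated   : dot inner (app (adjM G) outer) ≡ 0

remove : (u : Fin n → ℕ) (b : Fin n) → u b ≢ 0 → ∀ i → u i ≡ δ b i + (u i ∸ δ b i)
remove u b ub≢0 i with b ≟ᶠ i
... | no _     = refl
... | yes refl = sym (m+[n∸m]≡n (n≢0⇒n>0 ub≢0))

*≢0 : ∀ a b → a * b ≢ 0 → a ≢ 0 × b ≢ 0
*≢0 a b h = (λ eq → h (cong (_* b) eq)) , (λ eq → h (trans (cong (a *_) eq) (*-zeroʳ a)))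

-- Vertices of `outer` adjacent to `inner` are moved over one at a time. The number `j` of moves so
-- far bounds the distance from `x`, and `fuel` bounds the moves still to come, so `j + fuel ≤ t`
-- keeps the result within radius `t`.
closure : (G : Graph n) (t : ℕ) (s : Fin n → ℕ) (x : Fin n) (fuel : ℕ) (inner outer : Fin n → ℕ) (j : ℕ) →
          (∀ i → s i ≡ inner i + outer i) → 1 ≤ inner x → (∀ i → inner i ≢ 0 → ball G j x i ≡ true) →
          ∑ outer ≤ fuel → j + fuel ≤ t → Closure G t s x
closure {n} G t s x fuel inner outer j split root near size j≤t with dot inner (app (adjM G) outer) ≟ 0
... | yes sep = record
  { split = split ; root = root ; separated = sep
  ; near = λ i h → ball-mono G (≤⇒≤′ (≤-trans (m≤m+n j fuel) j≤t)) (near i h) }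
... | no ¬sep with a , pa ← ∑≢0 ¬sep with ia , ga ← *≢0 (inner a) _ pa with b , pb ← ∑≢0 ga
  with ab , ob ← *≢0 (adjM G a b) _ pb with fuel
...   | zero = contradiction (n≤0⇒n≡0 (≤-trans (≤∑ outer b) size)) ob
...   | suc fuel′ = closure G t s x fuel′ (λ i → inner i + δ b i) (λ i → outer i ∸ δ b i) (suc j)
  (λ i → trans (split i) (trans (cong (inner i +_) (remove outer b ob i)) (sym (+-assoc (inner i) _ _))))
  (≤-trans root (m≤m+n _ _)) near′ size′ (subst (_≤ t) (+-suc j fuel′) j≤t)
  where
  near′ : ∀ i → inner i + δ b i ≢ 0 → ball G (suc j) x i ≡ true
  near′ i h with b ≟ᶠ i
  ... | yes refl = ball-step G j (near a ia) (χ≢0 ab)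
  ... | no  _    = ∨-true⁺ˡ (near i (λ eq → h (trans (+-identityʳ _) eq)))
  size′ : ∑ (λ i → outer i ∸ δ b i) ≤ fuel′
  size′ = s≤s⁻¹ (≤-trans (≤-reflexive (sym (trans (trans (∑-cong (remove outer b ob)) (∑-+ (δ b) _))
    (cong (_+ ∑ (λ i → outer i ∸ δ b i)) (trans (∑-cong (λ i → sym (*-identityʳ (δ b i)))) (dot-δ b (λ _ → 1))))))) size)

-- Only a set containing both `x` and `y` is affected. As `y` is far, the part of the set connected
-- to `x` misses it. So the set splits into two nonempty parts without edges between them, each with
-- fewer edges than vertices; together they have at least two fewer, which leaves room for the new
-- edge.
sparse-∷ : (G : Graph n) {t : ℕ} {x y : Fin n} → Sparse t G → ball G t x y ≡ false → Sparse t ((x , y) ∷ G)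
sparse-∷ {n} G {t} {x} {y} sparse far s s≤1 s≥1 s≤t = ≤-trans (+-monoˡ-≤ 2 form≤) (bound (s x) (s y) refl refl)
  where
  form≤ : form (adjM ((x , y) ∷ G)) s ≤ form (adjM G) s + 2 * (s x * s y)
  form≤ = ≤-trans (form-mono (adjM-∷≤ G x y) s) (≤-reflexive (form-pairM (adjM G) x y s))
  unchanged : form (adjM G) s + 2 * 0 + 2 ≤ 2 * ∑ s
  unchanged = ≤-trans (≤-reflexive (cong (_+ 2) (+-identityʳ _))) (sparse s s≤1 s≥1 s≤t)
  joined : s x ≢ 0 → s y ≢ 0 → form (adjM G) s + 4 ≤ 2 * ∑ s
  joined sx sy = begin
    form (adjM G) s + 4                                        ≡⟨ cong (_+ 4) (trans (form-cong (adjM G) split) (form-+ (adjM-sym G) inner outer)) ⟩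
    form (adjM G) inner + form (adjM G) outer + 2 * dot inner (app (adjM G) outer) + 4
                                                               ≡⟨ cong (λ a → form (adjM G) inner + form (adjM G) outer + 2 * a + 4) separated ⟩
    form (adjM G) inner + form (adjM G) outer + 2 * 0 + 4      ≡⟨ rearrange (form (adjM G) inner) _ ⟩
    (form (adjM G) inner + 2) + (form (adjM G) outer + 2)      ≤⟨ +-mono-≤
      (sparse inner (λ i → ≤-trans (≤-trans (m≤m+n _ _) (≤-reflexive (sym (split i)))) (s≤1 i)) (≤-trans root (≤∑ inner x))
        (≤-trans (≤-trans (m≤m+n _ _) (≤-reflexive (sym sums))) s≤t))
      (sparse outer (λ i → ≤-trans (≤-trans (m≤n+m _ _) (≤-reflexive (sym (split i)))) (s≤1 i)) (≤-trans outer-y (≤∑ outer y))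
        (≤-trans (≤-trans (m≤n+m _ _) (≤-reflexive (sym sums))) s≤t)) ⟩
    2 * ∑ inner + 2 * ∑ outer                              ≡⟨ sym (*-distribˡ-+ 2 (∑ inner) (∑ outer)) ⟩
    2 * (∑ inner + ∑ outer)                                ≡⟨ cong (2 *_) (sym sums) ⟩
    2 * ∑ s                                                  ∎
    where
    open ≤-Reasoning
    cl : Closure G t s x
    cl = closure G t s x (∑ (λ i → s i ∸ δ x i)) (δ x) (λ i → s i ∸ δ x i) 0 (remove s x sx)
      (≤-reflexive (sym (δ-refl x))) (λ i h → χ≢0 h) ≤-refl
      (≤-trans (≤-trans (m≤n+m _ _) (≤-reflexive (sym (trans (∑-cong (remove s x sx)) (∑-+ (δ x) _))))) s≤t)
    open Closure cl
    sums : ∑ s ≡ ∑ inner + ∑ outer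
    sums = trans (∑-cong split) (∑-+ inner outer)
    outer-y : 1 ≤ outer y
    outer-y with inner y ≟ 0
    ... | no  iy   = ⊥-elim (true≢false (near y iy) far)
    ... | yes iy≡0 = n≢0⇒n>0 (λ oy≡0 → sy (trans (split y) (cong₂ _+_ iy≡0 oy≡0)))
    rearrange : ∀ a b → a + b + 2 * 0 + 4 ≡ (a + 2) + (b + 2)
    rearrange = solve-∀
  bound : ∀ a b → s x ≡ a → s y ≡ b → form (adjM G) s + 2 * (s x * s y) + 2 ≤ 2 * ∑ s
  bound zero b eqx eqy = subst (λ a → form (adjM G) s + 2 * (a * s y) + 2 ≤ 2 * ∑ s) (sym eqx) unchanged
  bound (suc a) zero eqx eqy = subst (λ c → form (adjM G) s + 2 * c + 2 ≤ 2 * ∑ s)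
    (sym (trans (cong (s x *_) eqy) (*-zeroʳ (s x)))) unchanged
  bound (suc a) (suc b) eqx eqy = begin
    form (adjM G) s + 2 * (s x * s y) + 2 ≤⟨ +-monoˡ-≤ 2 (+-monoʳ-≤ (form (adjM G) s) (*-monoʳ-≤ 2 (*-mono-≤ (s≤1 x) (s≤1 y)))) ⟩
    form (adjM G) s + 2 + 2               ≡⟨ +-assoc (form (adjM G) s) 2 2 ⟩
    form (adjM G) s + 4                   ≤⟨ joined (λ e → 1+n≢0 (trans (sym eqx) e)) (λ e → 1+n≢0 (trans (sym eqy) e)) ⟩
    2 * ∑ s                             ∎
    where open ≤-Reasoning

-- Exploring a tree vertex by vertex

-- The newest vertex comes first. The last condition of `leaf` is where acyclicity enters: an
-- extension to `c` has just one edge to respect, the one to `p`.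
data Explored (H : Graph t) : List (Fin t) → Set where
  root : ∀ r → Explored H (r ∷ [])
  leaf : ∀ {as} p c → Explored H as → p ∈ as → c ∉ as → adj H p c ≡ true →
         (∀ {q} → q ∈ as → adj H c q ≡ true → q ≡ p) → Explored H (c ∷ as)

infix 4 _∈?_
_∈?_ : (x : Fin t) (xs : List (Fin t)) → Dec (x ∈ xs)
_∈?_ = DecMembership._∈?_ _≟ᶠ_

walk-crosses : {H : Graph t} {u v : Fin t} (as : List (Fin t)) → Walk H u v → u ∈ as → v ∉ as →
               ∃[ p ] ∃[ c ] p ∈ as × c ∉ as × adj H p c ≡ true
walk-crosses as here u∈ v∉ = contradiction u∈ v∉
walk-crosses as (step {u} {w} uw wv) u∈ v∉ with w ∈? as
... | yes w∈ = walk-crosses as wv w∈ v∉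
... | no  w∉ = u , w , u∈ , w∉ , uw

-- The lists are free of repetitions so that their lengths count vertices and edges and compare with
-- `t` and `length H`.
record Span (H : Graph t) (as : List (Fin t)) (es : List (Edge t)) : Set where
  field
    vertices-unique : Unique as
    edges-unique    : Unique es
    edges-⊆         : ∀ {e} → e ∈ es → e ∈ H
    endpoints       : ∀ {e} → e ∈ es → proj₁ e ∈ as × proj₂ e ∈ as

Joins : Edge t → Fin t → Fin t → Set
Joins e u v = e ≡ (u , v) ⊎ e ≡ (v , u)

adj⇒Joins : {H : Graph t} {u v : Fin t} → adj H u v ≡ true → ∃[ e ] e ∈ H × Joins e u v
adj⇒Joins {H = H} uv with adj⁻ {G = H} uv
... | inj₁ e∈ = _ , e∈ , inj₁ refl
... | inj₂ e∈ = _ , e∈ , inj₂ refl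

Joins-≡ : {e : Edge t} {p q c : Fin t} → Joins e p c → Joins e q c → q ≡ p
Joins-≡ (inj₁ refl) (inj₁ refl) = refl
Joins-≡ (inj₁ refl) (inj₂ refl) = refl
Joins-≡ (inj₂ refl) (inj₁ refl) = refl
Joins-≡ (inj₂ refl) (inj₂ refl) = refl

module _ {H : Graph t} {as : List (Fin t)} {es : List (Edge t)} (span : Span H as es) where
  open Span span

  new-edge : {e : Edge t} {p c : Fin t} → c ∉ as → Joins e p c → e ∉ es
  new-edge c∉ (inj₁ refl) e∈ = c∉ (proj₂ (endpoints e∈))
  new-edge c∉ (inj₂ refl) e∈ = c∉ (proj₁ (endpoints e∈))

  Span-vertex : {e : Edge t} {p c : Fin t} → p ∈ as → c ∉ as → e ∈ H → Joins e p c → Span H (c ∷ as) (e ∷ es)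
  Span-vertex {e} {p} {c} p∈ c∉ e∈ ends = record
    { vertices-unique = All.tabulate (λ { x∈ refl → c∉ x∈ }) ∷ vertices-unique
    ; edges-unique    = All.tabulate (λ { x∈ refl → new-edge c∉ ends x∈ }) ∷ edges-unique
    ; edges-⊆         = λ { (here refl) → e∈ ; (there x∈) → edges-⊆ x∈ }
    ; endpoints       = λ { (here refl) → ends∈ ends ; (there x∈) → let u , v = endpoints x∈ in there u , there v }
    }
    where
    ends∈ : Joins e p c → proj₁ e ∈ c ∷ as × proj₂ e ∈ c ∷ as
    ends∈ (inj₁ refl) = there p∈ , here refl
    ends∈ (inj₂ refl) = here refl , there p∈

  Span-edge : {e : Edge t} {u v : Fin t} → u ∈ as → v ∈ as → e ∈ H → e ∉ es → Joins e u v → Span H as (e ∷ es)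
  Span-edge {e} {u} {v} u∈ v∈ e∈ e∉ ends = record
    { vertices-unique = vertices-unique
    ; edges-unique    = All.tabulate (λ { x∈ refl → e∉ x∈ }) ∷ edges-unique
    ; edges-⊆         = λ { (here refl) → e∈ ; (there x∈) → edges-⊆ x∈ }
    ; endpoints       = λ { (here refl) → ends∈ ends ; (there x∈) → endpoints x∈ }
    }
    where
    ends∈ : Joins e u v → proj₁ e ∈ as × proj₂ e ∈ as
    ends∈ (inj₁ refl) = u∈ , v∈
    ends∈ (inj₂ refl) = v∈ , u∈

length-unique≤ : {as : List (Fin t)} → Unique as → length as ≤ t
length-unique≤ {t} u = ≤-trans (Unique-⊆⇒length≤ u (λ {x} _ → ∈-allFin x)) (≤-reflexive (length-tabulate {n = t} id))

≤length-full : {as : List (Fin t)} → (∀ x → x ∈ as) → t ≤ length as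
≤length-full {t} full = ≤-trans (≤-reflexive (sym (length-tabulate {n = t} id)))
  (Unique-⊆⇒length≤ (Uniqueₚ.allFin⁺ t) (λ {x} _ → full x))

full? : (as : List (Fin t)) → (∀ x → x ∈ as) ⊎ ∃[ z ] z ∉ as
full? as with Finₚ.all? (_∈? as)
... | yes p = inj₁ p
... | no ¬p = inj₂ (Finₚ.¬∀⟶∃¬ _ (_∈ as) (_∈? as) ¬p)

module _ {H : Graph t} (connected : Connected H) (size : length H + 1 ≡ t) where

  -- A connected set spanning as many edges as it has vertices keeps this excess until it exhausts the tree.
  no-excess : ∀ fuel {r as es} → t ≤ length as + fuel → r ∈ as → Span H as es → ¬ length as ≤ length es
  no-excess fuel {r} {as} {es} fuel≥ r∈ span excess with full? as
  ... | inj₁ full = 1+n≰n (begin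
    suc (length H) ≡⟨ trans (+-comm 1 (length H)) size ⟩
    t              ≤⟨ ≤length-full full ⟩
    length as      ≤⟨ excess ⟩
    length es      ≤⟨ Unique-⊆⇒length≤ (Span.edges-unique span) (Span.edges-⊆ span) ⟩
    length H       ∎)
    where open ≤-Reasoning
  ... | inj₂ (z , z∉) with p , c , p∈ , c∉ , pc ← walk-crosses as (connected r z) r∈ z∉
    with e , e∈ , ends ← adj⇒Joins {H = H} pc with fuel
  ...   | zero = 1+n≰n (≤-trans (length-unique≤ (Span.vertices-unique (Span-vertex span p∈ c∉ e∈ ends)))
                                (≤-trans fuel≥ (≤-reflexive (+-identityʳ _))))
  ...   | suc fuel′ = no-excess fuel′ (≤-trans fuel≥ (≤-reflexive (+-suc _ fuel′))) (there r∈)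
                                (Span-vertex span p∈ c∉ e∈ ends) (s≤s excess)

  -- A second earlier neighbour of `c` would yield a connected set with as many edges as vertices,
  -- which `no-excess` forbids. `fuel` bounds the number of vertices not yet reached.
  explore : ∀ fuel {r as es} → t ≤ length as + fuel → r ∈ as → Span H as es → length as ≡ suc (length es) →
            Explored H as → ∃[ bs ] Explored H bs × (∀ x → x ∈ bs)
  explore fuel {r} {as} {es} fuel≥ r∈ span count ex with full? as
  ... | inj₁ full = as , ex , full
  ... | inj₂ (z , z∉) with p , c , p∈ , c∉ , pc ← walk-crosses as (connected r z) r∈ z∉
    with e , e∈ , ends ← adj⇒Joins {H = H} pc with fuel
  ...   | zero = contradiction (≤-trans (length-unique≤ (Span.vertices-unique (Span-vertex span p∈ c∉ e∈ ends)))
                                        (≤-trans fuel≥ (≤-reflexive (+-identityʳ _)))) 1+n≰n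
  ...   | suc fuel′ = explore fuel′ fuel≥′ (there r∈) span′ (cong suc count) (leaf p c ex p∈ c∉ pc only)
    where
    span′ : Span H (c ∷ as) (e ∷ es)
    span′ = Span-vertex span p∈ c∉ e∈ ends
    fuel≥′ : t ≤ suc (length as) + fuel′
    fuel≥′ = ≤-trans fuel≥ (≤-reflexive (+-suc _ fuel′))
    only : ∀ {q} → q ∈ as → adj H c q ≡ true → q ≡ p
    only {q} q∈ cq with q ≟ᶠ p
    ... | yes q≡p = q≡p
    ... | no  q≢p with e′ , e′∈ , ends′ ← adj⇒Joins {H = H} (adj-sym⁺ {G = H} cq) = ⊥-elim
      (no-excess fuel′ fuel≥′ (there r∈) (Span-edge span′ (there q∈) (here refl) e′∈ e′∉ ends′) (s≤s (≤-reflexive count)))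
      where
      distinct : e′ ≡ e → ⊥
      distinct refl = q≢p (Joins-≡ ends ends′)
      e′∉ : e′ ∉ e ∷ es
      e′∉ (here eq)  = distinct eq
      e′∉ (there x∈) = new-edge span c∉ ends′ x∈

tree-explored : {H : Graph t} → IsTree t H → ∃[ as ] Explored H as × (∀ x → x ∈ as)
tree-explored {zero}  {H} (_ , _ , size) = contradiction (trans (+-comm 1 (length H)) size) 1+n≢0
tree-explored {suc t} {H} (_ , connected , size) =
  explore connected size t ≤-refl (here refl)
    (record { vertices-unique = [] ∷ [] ; edges-unique = [] ; edges-⊆ = λ () ; endpoints = λ () }) refl (root zero)

-- Counting embeddings along an exploration

Loopless : Graph n → Set
Loopless G = ∀ v → adj G v v ≡ false

update : (Fin t → Fin n) → Fin t → Fin n → Fin t → Fin n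
update f c w a = if c =ᶠ a then w else f a

update-same : (f : Fin t → Fin n) (c : Fin t) (w : Fin n) → update f c w c ≡ w
update-same f c w rewrite =ᶠ-refl c = refl

update-other : (f : Fin t → Fin n) (c : Fin t) (w : Fin n) {a : Fin t} → c ≢ a → update f c w a ≡ f a
update-other f c w c≢a rewrite ≢⇒=ᶠ-false c≢a = refl

explored-unique : {H : Graph t} {as : List (Fin t)} → Explored H as → Unique as
explored-unique (root r) = [] ∷ []
explored-unique (leaf p c ex p∈ c∉ pc only) = All.tabulate (λ { x∈ refl → c∉ x∈ }) ∷ explored-unique ex

explored-root : {H : Graph t} {as : List (Fin t)} → Explored H as → Fin t
explored-root (root r) = r
explored-root (leaf p c ex _ _ _ _) = explored-root ex

root∈explored : {H : Graph t} {as : List (Fin t)} (ex : Explored H as) → explored-root ex ∈ as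
root∈explored (root r) = here refl
root∈explored (leaf p c ex _ _ _ _) = there (root∈explored ex)

back : Graph t → List (Fin t) → Fin t → List (Fin t)
back H as p = filterᵇ (adj H p) as

-- The number of embeddings of the explored part into a k-regular graph of large girth, with prescribed root.
weight : {H : Graph t} {as : List (Fin t)} → ℕ → Explored H as → ℕ
weight k (root r) = 1
weight {H = H} k (leaf {as} p c ex _ _ _ _) = weight k ex * (k ∸ length (back H as p))

extensions : Graph n → List (Fin t) → Fin t → (Fin t → Fin n) → List (Fin n)
extensions {n} G as p f = filterᵇ (λ w → adj G (f p) w ∧ not (any (λ a → f a =ᶠ w) as)) (allFin n)

-- Vertices not yet explored keep the placeholder value `v`, so only the values on the explored list
-- are meaningful.
partials : {H : Graph t} {as : List (Fin t)} → Graph n → Explored H as → Fin n → List (Fin t → Fin n)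
partials G (root r) v = (λ _ → v) ∷ []
partials G (leaf {as} p c ex _ _ _ _) v = concatMap (λ f → map (update f c) (extensions G as p f)) (partials G ex v)

∈-extensions⁺ : (G : Graph n) (as : List (Fin t)) (p : Fin t) (f : Fin t → Fin n) {w : Fin n} →
                adj G (f p) w ≡ true → (∀ {a} → a ∈ as → f a ≢ w) → w ∈ extensions G as p f
∈-extensions⁺ G as p f {w} fpw fresh = ∈-filterᵇ⁺ _ (∈-allFin w) (∧-true⁺ fpw (not-true⁺ (≢true⇒false
  (λ h → let a , a∈ , eq = any-true⁻ _ as h in fresh a∈ (=ᶠ⇒≡ eq)))))

∈-extensions⁻ : (G : Graph n) (as : List (Fin t)) (p : Fin t) (f : Fin t → Fin n) {w : Fin n} →
                w ∈ extensions G as p f → adj G (f p) w ≡ true × (∀ {a} → a ∈ as → f a ≢ w)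
∈-extensions⁻ {n} G as p f {w} w∈ with fpw , fresh ← ∧-true⁻ (proj₂ (∈-filterᵇ⁻ _ (allFin n) w∈)) =
  fpw , λ {a} a∈ eq → true≢false (any-true⁺ (λ a → f a =ᶠ w) a∈ (≡⇒=ᶠ eq)) (not-true⁻ fresh)

∈-partials⁻ : (G : Graph n) (as : List (Fin t)) (p c : Fin t) (fs : List (Fin t → Fin n)) {h : Fin t → Fin n} →
              h ∈ concatMap (λ f → map (update f c) (extensions G as p f)) fs →
              ∃[ f ] ∃[ w ] f ∈ fs × w ∈ extensions G as p f × h ≡ update f c w
∈-partials⁻ G as p c fs h∈ with f , f∈ , h∈′ ← concatMap⁻ _ fs h∈ with w , w∈ , eq ← ∈-map⁻ _ h∈′ = f , w , f∈ , w∈ , eq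

record PartialEmbedding (H : Graph t) (G : Graph n) (as : List (Fin t)) (f : Fin t → Fin n) : Set where
  field
    injective : ∀ {a b} → a ∈ as → b ∈ as → f a ≡ f b → a ≡ b
    hom       : ∀ {a b} → a ∈ as → b ∈ as → adj H a b ≡ true → adj G (f a) (f b) ≡ true

open PartialEmbedding

∉⇒≢ : {c a : Fin t} {as : List (Fin t)} → c ∉ as → a ∈ as → c ≢ a
∉⇒≢ c∉ a∈ refl = c∉ a∈

module _ {H : Graph t} (H-loopless : Loopless H) (G : Graph n) where

  module Extension {as : List (Fin t)} (p c : Fin t) (p∈ : p ∈ as) (c∉ : c ∉ as)
    (only : ∀ {q} → q ∈ as → adj H c q ≡ true → q ≡ p)
    (f : Fin t → Fin n) (w : Fin n) (w∈ : w ∈ extensions G as p f) where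

    f′ : Fin t → Fin n
    f′ = update f c w

    f′c : f′ c ≡ w
    f′c = update-same f c w

    f′a : ∀ {a} → a ∈ as → f′ a ≡ f a
    f′a a∈ = update-other f c w (∉⇒≢ c∉ a∈)

    fpw : adj G (f p) w ≡ true
    fpw = proj₁ (∈-extensions⁻ G as p f w∈)

    fresh : ∀ {a} → a ∈ as → f a ≢ w
    fresh = proj₂ (∈-extensions⁻ G as p f w∈)

    extend : PartialEmbedding H G as f → PartialEmbedding H G (c ∷ as) f′
    extend emb = record { injective = inj ; hom = hm }
      where
      inj : ∀ {a b} → a ∈ c ∷ as → b ∈ c ∷ as → f′ a ≡ f′ b → a ≡ b
      inj (here refl) (here refl) eq = refl
      inj (here refl) (there b∈)  eq = ⊥-elim (fresh b∈ (trans (sym (f′a b∈)) (trans (sym eq) f′c)))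
      inj (there a∈)  (here refl) eq = ⊥-elim (fresh a∈ (trans (sym (f′a a∈)) (trans eq f′c)))
      inj (there a∈)  (there b∈)  eq = injective emb a∈ b∈ (trans (sym (f′a a∈)) (trans eq (f′a b∈)))
      edge-c : ∀ {b} → b ∈ as → adj H c b ≡ true → adj G (f′ c) (f′ b) ≡ true
      edge-c b∈ cb with refl ← only b∈ cb =
        subst₂ (λ x y → adj G x y ≡ true) (sym f′c) (sym (f′a b∈)) (adj-sym⁺ {G = G} fpw)
      hm : ∀ {a b} → a ∈ c ∷ as → b ∈ c ∷ as → adj H a b ≡ true → adj G (f′ a) (f′ b) ≡ true
      hm (here refl) (here refl) ab = ⊥-elim (true≢false ab (H-loopless c))
      hm (here refl) (there b∈)  ab = edge-c b∈ ab
      hm (there a∈)  (here refl) ab = adj-sym⁺ {G = G} (edge-c a∈ (adj-sym⁺ {G = H} ab))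
      hm (there a∈)  (there b∈)  ab = subst₂ (λ x y → adj G x y ≡ true) (sym (f′a a∈)) (sym (f′a b∈)) (hom emb a∈ b∈ ab)

  partials-embed : ∀ {as} (ex : Explored H as) {v f} → f ∈ partials G ex v → PartialEmbedding H G as f
  partials-embed (root r) (here refl) = record
    { injective = λ { (here refl) (here refl) _ → refl }
    ; hom = λ { (here refl) (here refl) rr → ⊥-elim (true≢false rr (H-loopless r)) } }
  partials-embed (leaf {as} p c ex p∈ c∉ pc only) {v} h∈ with f , w , f∈ , w∈ , refl ← ∈-partials⁻ G as p c (partials G ex v) h∈ =
    Extension.extend p c p∈ c∉ only f w w∈ (partials-embed ex f∈)

  -- The images of the explored neighbours of `p` are distinct neighbours of `f p` and are already
  -- taken.
  extensions≤ : ∀ {k as p f} → (∀ v → degree G v ≤ k) → Unique as → p ∈ as → PartialEmbedding H G as f →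
                length (extensions G as p f) ≤ k ∸ length (back H as p)
  extensions≤ {k} {as} {p} {f} deg≤ uas p∈ emb = m+n≤o⇒m≤o∸n _ (begin
    length (extensions G as p f) + length (back H as p)                 ≡⟨ +-comm _ (length (back H as p)) ⟩
    length (back H as p) + length (extensions G as p f)                 ≡⟨ cong (_+ length (extensions G as p f)) (sym (length-map f (back H as p))) ⟩
    length (map f (back H as p)) + length (extensions G as p f)         ≡⟨ sym (length-++ (map f (back H as p))) ⟩
    length (map f (back H as p) ++ extensions G as p f)                 ≤⟨ Unique-⊆⇒length≤ unique sub ⟩
    degree G (f p)                                                      ≤⟨ deg≤ (f p) ⟩
    k                                                                   ∎)
    where
    open ≤-Reasoning
    unique : Unique (map f (back H as p) ++ extensions G as p f)
    unique = Uniqueₚ.++⁺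
      (Unique-map f (λ x∈ y∈ → injective emb (proj₁ (∈-filterᵇ⁻ _ as x∈)) (proj₁ (∈-filterᵇ⁻ _ as y∈))) (filterᵇ-unique _ uas))
      (filterᵇ-unique _ (Uniqueₚ.allFin⁺ n))
      (λ (x∈ , x∈′) → disjoint x∈ x∈′)
      where
      disjoint : ∀ {x} → x ∈ map f (back H as p) → x ∈ extensions G as p f → ⊥
      disjoint x∈ x∈′ with a , a∈ , refl ← ∈-map⁻ f x∈ = proj₂ (∈-extensions⁻ G as p f x∈′) (proj₁ (∈-filterᵇ⁻ _ as a∈)) refl
    sub : ∀ {x} → x ∈ map f (back H as p) ++ extensions G as p f → x ∈ nbrs G (f p)
    sub x∈ with ∈-++⁻ (map f (back H as p)) x∈
    ... | inj₂ x∈ext = ∈-nbrs⁺ {G = G} (proj₁ (∈-extensions⁻ G as p f x∈ext))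
    ... | inj₁ x∈map with a , a∈ , refl ← ∈-map⁻ f x∈map with a∈as , pa ← ∈-filterᵇ⁻ _ as a∈ =
      ∈-nbrs⁺ {G = G} (hom emb p∈ a∈as pa)

  partials≤ : ∀ {k as} → (∀ v → degree G v ≤ k) → (ex : Explored H as) (v : Fin n) → length (partials G ex v) ≤ weight k ex
  partials≤ deg≤ (root r) v = ≤-refl
  partials≤ {k} deg≤ (leaf {as} p c ex p∈ c∉ pc only) v = ≤-trans
    (length-concatMap≤ _ (k ∸ length (back H as p)) (partials G ex v) (λ {f} f∈ →
      ≤-trans (≤-reflexive (length-map (update f c) (extensions G as p f)))
              (extensions≤ deg≤ (explored-unique ex) p∈ (partials-embed ex f∈))))
    (*-monoˡ-≤ _ (partials≤ deg≤ ex v))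

  partials-complete : ∀ {as} (ex : Explored H as) {h : Fin t → Fin n} → IsEmbedding H G h →
                      ∃[ f ] f ∈ partials G ex (h (explored-root ex)) × (∀ {a} → a ∈ as → f a ≡ h a)
  partials-complete (root r) emb = _ , here refl , λ { (here refl) → refl }
  partials-complete (leaf {as} p c ex p∈ c∉ pc only) {h} emb with f , f∈ , agree ← partials-complete ex emb =
    update f c (h c) , concatMap⁺ _ f∈ (∈-map⁺ _ ext) , agree′
    where
    ext : h c ∈ extensions G as p f
    ext = ∈-extensions⁺ G as p f (subst (λ x → adj G x (h c) ≡ true) (sym (agree p∈)) (proj₂ emb pc))
      (λ a∈ eq → ∉⇒≢ c∉ a∈ (proj₁ emb (trans (sym eq) (agree a∈))))
    agree′ : ∀ {a} → a ∈ c ∷ as → update f c (h c) a ≡ h a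
    agree′ (here refl) = update-same f c (h c)
    agree′ (there a∈)  = trans (update-other f c (h c) (∉⇒≢ c∉ a∈)) (agree a∈)

  -- An embedding is recovered from the image of the root and the choices made along the
  -- exploration, since every vertex is explored.
  embeddings≤ : ∀ {k as} → (∀ v → degree G v ≤ k) → (ex : Explored H as) → (∀ x → x ∈ as) →
                length (embeddings H G) ≤ n * weight k ex
  embeddings≤ {k} {as} deg≤ ex full = begin
    length (embeddings H G)                        ≤⟨ match-length≤ (λ h f → f ≗ h) (embeddings-distinct H G)
      (λ {h} h∈ → let f , f∈ , agree = partials-complete ex (∈-embeddings⁻ {H = H} {G} h∈) in
        f , concatMap⁺ (partials G ex) (∈-allFin (h (explored-root ex))) f∈ , λ x → agree (full x))
      (λ h≇h′ p q → h≇h′ (λ x → trans (sym (p x)) (q x))) ⟩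
    length (concatMap (partials G ex) (allFin n))  ≤⟨ length-concatMap≤ _ (weight k ex) (allFin n) (λ {v} _ → partials≤ deg≤ ex v) ⟩
    length (allFin n) * weight k ex                ≡⟨ cong (_* weight k ex) (length-tabulate {n = n} id) ⟩
    n * weight k ex                                ∎
    where open ≤-Reasoning

-- Partial embeddings into sparse graphs

∑-δ-+ : (u : Fin n → ℕ) (i : Fin n) → ∑ (λ j → u j + δ i j) ≡ suc (∑ u)
∑-δ-+ u i = trans (∑-+ u (δ i)) (trans (cong (∑ u +_) (trans (∑-cong (λ j → sym (*-identityʳ (δ i j)))) (dot-δ i (λ _ → 1)))) (+-comm (∑ u) 1))

two≤∑ : (u : Fin n → ℕ) {i j : Fin n} → i ≢ j → u i + u j ≤ ∑ u
two≤∑ u {i} {j} i≢j = ≤-trans (≤-reflexive (sym (trans (∑-+ (λ x → δ i x * u x) (λ x → δ j x * u x)) (cong₂ _+_ (dot-δ i u) (dot-δ j u)))))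
  (∑-mono pointwise)
  where
  pointwise : ∀ x → δ i x * u x + δ j x * u x ≤ u x
  pointwise x with i ≟ᶠ x | j ≟ᶠ x
  ... | yes refl | yes refl = contradiction refl i≢j
  ... | yes _    | no  _    = ≤-reflexive (trans (+-identityʳ _) (+-identityʳ _))
  ... | no  _    | yes _    = ≤-reflexive (+-identityʳ _)
  ... | no  _    | no  _    = z≤n

-- Radius `t` covers all vertices that an embedding of a tree on `t` vertices with root image `v`
-- can reach.
Saturated : Graph n → ℕ → ℕ → Fin n → Set
Saturated G t k v = ∀ u → ball G t u v ≡ true → k ≤ degree G u

-- image-edges says that the image spans at least length as - 1 edges, as the form counts ordered pairs.
record TreeImage (H : Graph t) (G : Graph n) (as : List (Fin t)) (v : Fin n) (f : Fin t → Fin n) : Set where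
  field
    image       : Fin n → ℕ
    image≤1     : ∀ i → image i ≤ 1
    image-⊇     : ∀ {a} → a ∈ as → image (f a) ≡ 1
    image-⊆     : ∀ {i} → image i ≢ 0 → ∃[ a ] a ∈ as × f a ≡ i
    image-size  : ∑ image ≡ length as
    image-edges : 2 * ∑ image ≤ form (adjM G) image + 2
    induced     : ∀ {a b} → a ∈ as → b ∈ as → adj G (f a) (f b) ≡ true → adj H a b ≡ true
    near        : ∀ {a} → a ∈ as → ball G (length as) (f a) v ≡ true

module _ {H : Graph t} (H-loopless : Loopless H) {G : Graph n} (G-loopless : Loopless G) (sparse : Sparse t G) where

  module Grow {as : List (Fin t)} {p c : Fin t} (p∈ : p ∈ as) (c∉ : c ∉ as) (unique : Unique (c ∷ as))
    (pc : adj H p c ≡ true) (only : ∀ {q} → q ∈ as → adj H c q ≡ true → q ≡ p)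
    {f : Fin t → Fin n} {w v : Fin n} (w∈ : w ∈ extensions G as p f)
    (emb : PartialEmbedding H G as f) (tree : TreeImage H G as v f) where

    open Extension {H = H} H-loopless G p c p∈ c∉ only f w w∈
    open TreeImage tree

    w-new : image w ≡ 0
    w-new with image w ≟ 0
    ... | yes eq = eq
    ... | no neq with a , a∈ , fa≡w ← image-⊆ neq = ⊥-elim (fresh a∈ fa≡w)

    image′ : Fin n → ℕ
    image′ i = image i + δ w i

    links : ℕ
    links = dot image (app (adjM G) (δ w))

    link : Fin n → ℕ
    link i = image i * app (adjM G) (δ w) i

    link≡1 : ∀ {a} → a ∈ as → adj G (f a) w ≡ true → link (f a) ≡ 1
    link≡1 {a} a∈ faw = cong₂ _*_ (image-⊇ a∈) (trans (app-δ (adjM G) w (f a)) (χ-true faw))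

    image′≤1 : ∀ i → image′ i ≤ 1
    image′≤1 i with w ≟ᶠ i
    ... | yes refl = ≤-reflexive (cong (_+ 1) w-new)
    ... | no  _    = ≤-trans (≤-reflexive (+-identityʳ _)) (image≤1 i)

    image′-size : ∑ image′ ≡ suc (length as)
    image′-size = trans (∑-δ-+ image w) (cong suc image-size)

    -- The new vertex adds `links` edges to an image that already had at least its size minus one.
    -- The value 1 for `l` restores the invariant; the value 2 contradicts sparsity.
    edges≥ : ∀ l → l ≤ links → 2 * ∑ image′ + 2 * l ≤ form (adjM G) image′ + 4
    edges≥ l l≤ = begin
      2 * ∑ image′ + 2 * l                         ≡⟨ cong (λ a → 2 * a + 2 * l) (∑-δ-+ image w) ⟩
      2 * suc (∑ image) + 2 * l                    ≡⟨ rearrange (∑ image) l ⟩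
      2 * ∑ image + (2 * l + 2)                    ≤⟨ +-mono-≤ image-edges (+-monoˡ-≤ 2 (*-monoʳ-≤ 2 l≤)) ⟩
      form (adjM G) image + 2 + (2 * links + 2)    ≤⟨ m≤m+n _ (form (adjM G) (δ w)) ⟩
      form (adjM G) image + 2 + (2 * links + 2) + form (adjM G) (δ w)
                                                   ≡⟨ rearrange′ (form (adjM G) image) links (form (adjM G) (δ w)) ⟩
      form (adjM G) image + form (adjM G) (δ w) + 2 * links + 4
                                                   ≡⟨ cong (_+ 4) (sym (form-+ (adjM-sym G) image (δ w))) ⟩
      form (adjM G) image′ + 4                     ∎
      where
      open ≤-Reasoning
      rearrange : ∀ a l → 2 * suc a + 2 * l ≡ 2 * a + (2 * l + 2)
      rearrange = solve-∀
      rearrange′ : ∀ a b d → a + 2 + (2 * b + 2) + d ≡ a + d + 2 * b + 4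
      rearrange′ = solve-∀

    size≤t : ∑ image′ ≤ t
    size≤t = ≤-trans (≤-reflexive image′-size) (length-unique≤ unique)

    -- A second neighbour of w in the image would close a short cycle.
    new-edge-only : ∀ {b} → b ∈ as → adj G w (f b) ≡ true → b ≡ p
    new-edge-only {b} b∈ wfb with b ≟ᶠ p
    ... | yes b≡p = b≡p
    ... | no  b≢p = ⊥-elim (1+n≰n (≤-trans (s≤s (m≤n+m _ 1)) (+-cancelʳ-≤ 2 (2 + 2 * ∑ image′) _ (begin
      2 + 2 * ∑ image′ + 2         ≡⟨ rearrange (∑ image′) ⟩
      2 * ∑ image′ + 2 * 2         ≤⟨ edges≥ 2 two ⟩
      form (adjM G) image′ + 4     ≡⟨ sym (+-assoc (form (adjM G) image′) 2 2) ⟩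
      form (adjM G) image′ + 2 + 2 ≤⟨ +-monoˡ-≤ 2 (sparse image′ image′≤1 (≤-trans (s≤s z≤n) (≤-reflexive (sym image′-size))) size≤t) ⟩
      2 * ∑ image′ + 2             ∎))))
      where
      open ≤-Reasoning
      rearrange : ∀ a → 2 + 2 * a + 2 ≡ 2 * a + 2 * 2
      rearrange = solve-∀
      two : 2 ≤ links
      two = ≤-trans (≤-reflexive (sym (cong₂ _+_ (link≡1 b∈ (adj-sym⁺ {G = G} wfb)) (link≡1 p∈ fpw))))
        (two≤∑ link (λ eq → b≢p (injective emb b∈ p∈ eq)))

    grow : TreeImage H G (c ∷ as) v f′
    grow = record
      { image = image′ ; image≤1 = image′≤1
      ; image-⊇ = λ { (here refl) → trans (cong image′ f′c) (cong₂ _+_ w-new (δ-refl w))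
                    ; (there a∈) → trans (cong image′ (f′a a∈)) (cong₂ _+_ (image-⊇ a∈) (δ-≢ (fresh a∈ ∘ sym))) }
      ; image-⊆ = ⊆′
      ; image-size = image′-size
      ; image-edges = +-cancelʳ-≤ 2 (2 * ∑ image′) (form (adjM G) image′ + 2) (≤-trans (edges≥ 1 one) (≤-reflexive (sym (+-assoc (form (adjM G) image′) 2 2))))
      ; induced = induced′
      ; near = λ { (here refl) → subst (λ x → ball G (suc (length as)) x v ≡ true) (sym f′c)
                                   (ball-prefix G (length as) (adj-sym⁺ {G = G} fpw) (near p∈))
                 ; (there a∈) → subst (λ x → ball G (suc (length as)) x v ≡ true) (sym (f′a a∈))
                                   (ball-mono G {length as} (≤′-step ≤′-refl) (near a∈)) }
      }
      where
      one : 1 ≤ links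
      one = ≤-trans (≤-reflexive (sym (link≡1 p∈ fpw))) (≤∑ link (f p))
      ⊆′ : ∀ {i} → image′ i ≢ 0 → ∃[ a ] a ∈ c ∷ as × f′ a ≡ i
      ⊆′ {i} h with w ≟ᶠ i
      ... | yes refl = c , here refl , f′c
      ... | no  _ with a , a∈ , eq ← image-⊆ (λ z → h (trans (+-identityʳ _) z)) = a , there a∈ , trans (f′a a∈) eq
      edge-c : ∀ {b} → b ∈ as → adj G (f′ c) (f′ b) ≡ true → adj H c b ≡ true
      edge-c b∈ cb with refl ← new-edge-only b∈ (subst₂ (λ x y → adj G x y ≡ true) f′c (f′a b∈) cb) = adj-sym⁺ {G = H} pc
      induced′ : ∀ {a b} → a ∈ c ∷ as → b ∈ c ∷ as → adj G (f′ a) (f′ b) ≡ true → adj H a b ≡ true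
      induced′ (here refl) (here refl) ab = ⊥-elim (true≢false ab (G-loopless (f′ c)))
      induced′ (here refl) (there b∈)  ab = edge-c b∈ ab
      induced′ (there a∈)  (here refl) ab = adj-sym⁺ {G = H} (edge-c a∈ (adj-sym⁺ {G = G} ab))
      induced′ (there a∈)  (there b∈)  ab = induced a∈ b∈ (subst₂ (λ x y → adj G x y ≡ true) (f′a a∈) (f′a b∈) ab)

  partials-tree : ∀ {as} (ex : Explored H as) {v f} → f ∈ partials G ex v → TreeImage H G as v f
  partials-tree (root r) {v} (here refl) = record
    { image = δ v ; image≤1 = λ i → χ≤1 (v =ᶠ i)
    ; image-⊇ = λ { (here refl) → δ-refl v }
    ; image-⊆ = λ h → r , here refl , =ᶠ⇒≡ (χ≢0 h)
    ; image-size = size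
    ; image-edges = ≤-trans (≤-reflexive (cong (2 *_) size)) (m≤n+m 2 _)
    ; induced = λ { (here refl) (here refl) vv → ⊥-elim (true≢false vv (G-loopless v)) }
    ; near = λ { (here refl) → ball-refl G 1 v } }
    where
    size : ∑ (δ v) ≡ 1
    size = trans (∑-cong (λ j → sym (*-identityʳ (δ v j)))) (dot-δ v (λ _ → 1))
  partials-tree (leaf {as} p c ex p∈ c∉ pc only) {v} h∈ with f , w , f∈ , w∈ , refl ← ∈-partials⁻ G as p c (partials G ex v) h∈ =
    Grow.grow p∈ c∉ (explored-unique (leaf p c ex p∈ c∉ pc only)) pc only w∈ (partials-embed H-loopless G ex f∈) (partials-tree ex f∈)

  -- Here `induced` is essential: a neighbour of `f p` that is already used must be the image of a
  -- neighbour of `p`, so the only choices lost are those counted by `back`.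
  extensions≥ : ∀ {k as p f v} → Saturated G t k v → Unique as → p ∈ as → TreeImage H G as v f →
                k ∸ length (back H as p) ≤ length (extensions G as p f)
  extensions≥ {k} {as} {p} {f} {v} sat uas p∈ tree = m≤n+o⇒m∸n≤o k (length (back H as p)) (begin
    k                                                           ≤⟨ sat (f p) (ball-mono G (≤⇒≤′ (length-unique≤ uas)) (near p∈)) ⟩
    degree G (f p)                                              ≤⟨ Unique-⊆⇒length≤ (nbrs-unique G (f p)) sub ⟩
    length (map f (back H as p) ++ extensions G as p f)         ≡⟨ length-++ (map f (back H as p)) ⟩
    length (map f (back H as p)) + length (extensions G as p f) ≡⟨ cong (_+ length (extensions G as p f)) (length-map f (back H as p)) ⟩
    length (back H as p) + length (extensions G as p f)         ∎)
    where
    open ≤-Reasoning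
    open TreeImage tree
    sub : ∀ {x} → x ∈ nbrs G (f p) → x ∈ map f (back H as p) ++ extensions G as p f
    sub {x} x∈ with any (λ a → f a =ᶠ x) as in eq
    ... | true with a , a∈ , fa≡x ← any-true⁻ _ as eq with refl ← =ᶠ⇒≡ fa≡x =
      ∈-++⁺ˡ (∈-map⁺ f (∈-filterᵇ⁺ _ a∈ (induced p∈ a∈ (∈-nbrs⁻ {G = G} x∈))))
    ... | false = ∈-++⁺ʳ (map f (back H as p)) (∈-extensions⁺ G as p f (∈-nbrs⁻ {G = G} x∈)
      (λ a∈ fa≡x → true≢false (any-true⁺ (λ a → f a =ᶠ x) a∈ (≡⇒=ᶠ fa≡x)) eq))

  partials≥ : ∀ {k as v} → Saturated G t k v → (ex : Explored H as) → weight k ex ≤ length (partials G ex v)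
  partials≥ sat (root r) = ≤-refl
  partials≥ {k} {v = v} sat (leaf {as} p c ex p∈ c∉ pc only) = ≤-trans (*-monoˡ-≤ _ (partials≥ sat ex))
    (length-concatMap≥ _ (k ∸ length (back H as p)) (partials G ex v) (λ {f} f∈ →
      ≤-trans (extensions≥ sat (explored-unique ex) p∈ (partials-tree ex f∈))
              (≤-reflexive (sym (length-map (update f c) (extensions G as p f))))))

DistinctOn : List (Fin t) → List (Fin t → Fin n) → Set
DistinctOn as = AllPairs (λ f h → ¬ (∀ {a} → a ∈ as → f a ≡ h a))

partials-root : {H : Graph t} {G : Graph n} {as : List (Fin t)} (ex : Explored H as) {v : Fin n} {f : Fin t → Fin n} →
                f ∈ partials G ex v → f (explored-root ex) ≡ v
partials-root (root r) (here refl) = refl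
partials-root {G = G} (leaf {as} p c ex p∈ c∉ pc only) {v} h∈ with f , w , f∈ , w∈ , refl ← ∈-partials⁻ G as p c (partials G ex v) h∈ =
  trans (update-other f c w (∉⇒≢ c∉ (root∈explored ex))) (partials-root {G = G} ex f∈)

partials-distinct : {H : Graph t} {G : Graph n} {as : List (Fin t)} (ex : Explored H as) (v : Fin n) →
                    DistinctOn as (partials G ex v)
partials-distinct (root r) v = [] ∷ []
partials-distinct {n = n} {G = G} (leaf {as} p c ex p∈ c∉ pc only) v = AllPairs-concatMap _ (partials-distinct {G = G} ex v)
  (λ f → AllPairsₚ.map⁺ (AllPairs.map (λ w≢w′ same → w≢w′ (trans (sym (update-same f c _)) (trans (same (here refl)) (update-same f c _))))
    (filterᵇ-unique _ (Uniqueₚ.allFin⁺ n))))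
  (λ f≇h a∈ b∈ same → f≇h (λ x∈ → old a∈ b∈ same x∈))
  where
  old : ∀ {f h a b} {ws zs : List (Fin n)} → a ∈ map (update f c) ws → b ∈ map (update h c) zs →
        (∀ {x} → x ∈ c ∷ as → a x ≡ b x) → ∀ {x} → x ∈ as → f x ≡ h x
  old {f} {h} a∈ b∈ same x∈ with w , _ , refl ← ∈-map⁻ _ a∈ with z , _ , refl ← ∈-map⁻ _ b∈ =
    trans (sym (update-other f c w (∉⇒≢ c∉ x∈))) (trans (same (there x∈)) (update-other h c z (∉⇒≢ c∉ x∈)))

-- Roots far from every deficient vertex

deficit : ℕ → Graph n → Fin n → ℕ
deficit k G v = k ∸ degree G v

module _ {H : Graph t} (H-loopless : Loopless H) {G : Graph n} (G-loopless : Loopless G) (sparse : Sparse t G)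
  {k : ℕ} (deg≤ : ∀ v → degree G v ≤ k) where

  nearDeficient : Fin n → Bool
  nearDeficient v = anyB (λ u → (degree G u <ᵇ k) ∧ ball G t u v)

  saturated : List (Fin n)
  saturated = filterᵇ (not ∘ nearDeficient) (allFin n)

  ∈-saturated⁻ : ∀ {v} → v ∈ saturated → Saturated G t k v
  ∈-saturated⁻ {v} v∈ u uv with k ≤? degree G u
  ... | yes k≤ = k≤
  ... | no  k≰ = ⊥-elim (true≢false
    (anyB⁺ {p = λ u → (degree G u <ᵇ k) ∧ ball G t u v} {u} (∧-true⁺ (Equivalence.to T-≡ (<⇒<ᵇ (≰⇒> k≰))) uv))
    (not-true⁻ (proj₂ (∈-filterᵇ⁻ _ (allFin n) v∈))))

  -- Every other vertex is charged to a deficient vertex within distance `t`. Each of these has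
  -- deficit at least 1 and receives at most a ball of charges.
  saturated-count : n ≤ length saturated + ∑ (deficit k G) * suc k ^ t
  saturated-count = begin
    n                                                            ≡⟨ sym ∑1 ⟩
    ∑ (λ (_ : Fin n) → 1)                                        ≤⟨ ∑-mono cover ⟩
    ∑ (λ v → χ (not (nearDeficient v)) + ∑ (λ u → deficit k G u * χ (ball G t u v)))
                                                                 ≡⟨ ∑-+ (λ v → χ (not (nearDeficient v))) _ ⟩
    ∑ (λ v → χ (not (nearDeficient v))) + ∑ (λ v → ∑ (λ u → deficit k G u * χ (ball G t u v)))
                                                                 ≡⟨ cong₂ _+_ (sym (length-filterᵇ-tabulate (not ∘ nearDeficient) id)) (∑-swap (λ v u → deficit k G u * χ (ball G t u v))) ⟩
    length saturated + ∑ (λ u → ∑ (λ v → deficit k G u * χ (ball G t u v)))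
                                                                 ≤⟨ +-monoʳ-≤ (length saturated) (∑-mono (λ u →
      ≤-trans (≤-reflexive (sym (*-distribˡ-∑ (deficit k G u) _))) (*-monoʳ-≤ (deficit k G u) (ball-size G deg≤ t u)))) ⟩
    length saturated + ∑ (λ u → deficit k G u * suc k ^ t)       ≡⟨ cong (length saturated +_) (sym (*-distribʳ-∑ (suc k ^ t) (deficit k G))) ⟩
    length saturated + ∑ (deficit k G) * suc k ^ t               ∎
    where
    open ≤-Reasoning
    ∑1 : ∑ (λ (_ : Fin n) → 1) ≡ n
    ∑1 = trans (sym (length-filterᵇ-tabulate {n = n} (λ _ → true) id)) (trans (cong length filter-all) (length-tabulate {n = n} id))
      where
      filter-all : filterᵇ (λ _ → true) (allFin n) ≡ allFin n
      filter-all = all-kept (allFin n)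
        where
        all-kept : (xs : List (Fin n)) → filterᵇ (λ _ → true) xs ≡ xs
        all-kept []       = refl
        all-kept (x ∷ xs) = cong (x ∷_) (all-kept xs)
    cover : ∀ v → 1 ≤ χ (not (nearDeficient v)) + ∑ (λ u → deficit k G u * χ (ball G t u v))
    cover v with nearDeficient v in eq
    ... | false = s≤s z≤n
    ... | true with u , p ← anyB⁻ {p = λ u → (degree G u <ᵇ k) ∧ ball G t u v} eq with u<k , uv ← ∧-true⁻ p =
      ≤-trans (*-mono-≤ (m<n⇒0<n∸m (<ᵇ⇒< (degree G u) k (Equivalence.from T-≡ u<k))) (≤-reflexive (sym (χ-true uv))))
        (≤∑ (λ u → deficit k G u * χ (ball G t u v)) u)

  -- Maps over different roots differ at the root, so the full weights contributed by the saturated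
  -- vertices add up; only the remaining roots are lost.
  embeddings≥ : ∀ {as} (ex : Explored H as) → (∀ x → x ∈ as) →
                n * weight k ex ≤ length (embeddings H G) + ∑ (deficit k G) * suc k ^ t * weight k ex
  embeddings≥ {as} ex full = begin
    n * weight k ex                                                      ≤⟨ *-monoˡ-≤ (weight k ex) saturated-count ⟩
    (length saturated + ∑ (deficit k G) * suc k ^ t) * weight k ex       ≡⟨ *-distribʳ-+ (weight k ex) (length saturated) _ ⟩
    length saturated * weight k ex + ∑ (deficit k G) * suc k ^ t * weight k ex
                                                                         ≤⟨ +-monoˡ-≤ _ (length-concatMap≥ (partials G ex) (weight k ex) saturated
      (λ v∈ → partials≥ H-loopless G-loopless sparse (∈-saturated⁻ v∈) ex)) ⟩
    length (concatMap (partials G ex) saturated) + ∑ (deficit k G) * suc k ^ t * weight k ex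
                                                                         ≤⟨ +-monoˡ-≤ _ (match-length≤ (λ f h → f ≗ h) distinct embeds
      (λ f≇f′ p q → f≇f′ (λ {x} _ → trans (p x) (sym (q x))))) ⟩
    length (embeddings H G) + ∑ (deficit k G) * suc k ^ t * weight k ex  ∎
    where
    open ≤-Reasoning
    distinct : DistinctOn as (concatMap (partials G ex) saturated)
    distinct = AllPairs-concatMap (partials G ex) (filterᵇ-unique _ (Uniqueₚ.allFin⁺ n)) (partials-distinct {G = G} ex)
      (λ v≢v′ f∈ f′∈ same → v≢v′ (trans (sym (partials-root {G = G} ex f∈)) (trans (same (root∈explored ex)) (partials-root {G = G} ex f′∈))))
    embeds : ∀ {f} → f ∈ concatMap (partials G ex) saturated → ∃[ h ] h ∈ embeddings H G × f ≗ h
    embeds f∈ with v , v∈ , f∈′ ← concatMap⁻ (partials G ex) saturated f∈ =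
      let emb = partials-embed H-loopless G ex f∈′
          h , h∈ , h≗f = ∈-embeddings⁺ {H = H} {G} ((λ {x} {y} → injective emb (full x) (full y)) , (λ {x} {y} → hom emb (full x) (full y)))
      in h , h∈ , sym ∘ h≗f

-- Constructor's strategy

argmax : (d φ : Fin n → ℕ) {i : Fin n} → d i ≢ 0 → ∃[ x ] d x ≢ 0 × (∀ z → d z ≢ 0 → φ z ≤ φ x)
argmax {suc n} d φ {i} di with Finₚ.any? (λ j → ¬? (d (suc j) ≟ 0))
... | no none = zero , d0 i di , λ { zero _ → ≤-refl ; (suc j) dj → contradiction (j , dj) none }
  where
  d0 : ∀ i → d i ≢ 0 → d zero ≢ 0
  d0 zero    di = di
  d0 (suc j) dj = contradiction (j , dj) none
... | yes (j , dj) with x , dx , max ← argmax (d ∘ suc) (φ ∘ suc) dj with d zero ≟ 0 | φ zero ≤? φ (suc x)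
...   | yes d0≡0 | _      = suc x , dx , λ { zero d0 → contradiction d0≡0 d0 ; (suc z) dz → max z dz }
...   | no  _    | yes le = suc x , dx , λ { zero _ → le ; (suc z) dz → max z dz }
...   | no  d0   | no  gt = zero , d0 , λ { zero _ → ≤-refl ; (suc z) dz → ≤-trans (max z dz) (<⇒≤ (≰⇒> gt)) }

ball-sym : (G : Graph n) (j : ℕ) {x y : Fin n} → ball G j x y ≡ true → ball G j y x ≡ true
ball-sym G zero    h = ≡⇒=ᶠ (sym (=ᶠ⇒≡ h))
ball-sym G (suc j) {x} {y} h with ∨-true⁻ h
... | inj₁ p = ∨-true⁺ˡ (ball-sym G j p)
... | inj₂ p with z , q ← anyB⁻ {p = λ z → ball G j x z ∧ adj G z y} p = let xz , zy = ∧-true⁻ q in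
  ball-prefix G j (adj-sym⁺ {G = G} zy) (ball-sym G j xz)

-- Here `m` is the largest threat. If it is at least a quarter of `W`, then the drop of the danger,
-- at least `2 * m`, pays for the constant terms `S`. Otherwise the threat term, the danger and `S`
-- are at most 4, 1 and 3 times `c * W`; this is the origin of the factor 8. The factor 16 is twice
-- as large because threats are held to half of `W`.
spread-arith : ∀ c K k m W Φ φy φz → 1 ≤ c → φz ≤ m → 16 * c * m + Φ ≤ 8 * c * W → Φ ≤ c * W →
               32 * c * k + 4 * K + 32 * c ≤ W → 16 * c * (φz + k) + Φ + 2 * K + 16 * c ≤ 8 * c * W + 2 * (m + φy)
spread-arith c K k m W Φ φy φz c≥1 φz≤m spread light large = ≤-trans
  (+-monoˡ-≤ (16 * c) (+-monoˡ-≤ (2 * K) (+-monoˡ-≤ Φ (*-monoʳ-≤ (16 * c) (+-monoˡ-≤ k φz≤m)))))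
  (≤-trans (≤-reflexive (expand c K k m Φ)) main)
  where
  open ≤-Reasoning
  S : ℕ
  S = 16 * c * k + 2 * K + 16 * c
  expand : ∀ c K k m Φ → 16 * c * (m + k) + Φ + 2 * K + 16 * c ≡ 16 * c * m + Φ + (16 * c * k + 2 * K + 16 * c)
  expand = solve-∀
  double : ∀ c K k → 2 * (16 * c * k + 2 * K + 16 * c) ≡ 32 * c * k + 4 * K + 32 * c
  double = solve-∀
  quadruple : ∀ m → 4 * m ≡ 2 * (2 * m)
  quadruple = solve-∀
  regroup : ∀ c m → 16 * c * m ≡ 4 * c * (4 * m)
  regroup = solve-∀
  total : ∀ c W → 4 * c * W + c * W + 3 * (c * W) ≡ 8 * c * W
  total = solve-∀
  2S≤W : 2 * S ≤ W
  2S≤W = ≤-trans (≤-reflexive (double c K k)) large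
  main : 16 * c * m + Φ + S ≤ 8 * c * W + 2 * (m + φy)
  main with W ≤? 4 * m
  ... | yes W≤4m = +-mono-≤ spread (≤-trans (*-cancelˡ-≤ 2 (≤-trans 2S≤W (≤-trans W≤4m (≤-reflexive (quadruple m)))))
                                            (*-monoʳ-≤ 2 (m≤m+n m φy)))
  ... | no  W≰4m = ≤-trans (begin
    16 * c * m + Φ + S                  ≤⟨ +-mono-≤ (+-mono-≤ (≤-trans (≤-reflexive (regroup c m)) (*-monoʳ-≤ (4 * c) (<⇒≤ (≰⇒> W≰4m)))) light) S≤ ⟩
    4 * c * W + c * W + 3 * (c * W)     ≡⟨ total c W ⟩
    8 * c * W                           ∎) (m≤m+n _ _)
    where
    S≤ : S ≤ 3 * (c * W)
    S≤ = ≤-trans (m≤m+n S (S + 0)) (≤-trans 2S≤W (≤-trans (≤-trans (≤-reflexive (sym (*-identityˡ W))) (*-monoˡ-≤ W c≥1)) (m≤m+n (c * W) _)))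

module Game (k t : ℕ) where

  -- The three summands of threshold are the bounds large₁, large₂ and large₃ needed by a good move.
  K c R E threshold : ℕ
  K = k * k
  c = suc K
  R = suc k ^ t * k
  E = suc (2 * K)
  threshold = 2 * R + (32 * c * k + 4 * K + 32 * c) + (E * (E + R) + 2 * K + 2 * c)

  threat : Graph n → Graph n → Fin n → ℕ
  threat C B = app (adjM B) (deficit k C)

  -- Each edge uv of Blocker counts twice, with weight deficit u * deficit v.
  danger : Graph n → Graph n → ℕ
  danger C B = form (adjM B) (deficit k C)

  slack : Graph n → ℕ
  slack C = ∑ (deficit k C)

  record Board (C B : Graph n) : Set where
    field
      C-loopless : Loopless C
      B-loopless : Loopless B
      degrees    : ∀ v → degree C v ≤ k
      sparse     : Sparse t C

  -- spread makes the threat to any deficient vertex at most half of the slack, so that a most threatened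
  -- vertex can always be joined to some other one.
  record Position (C B : Graph n) : Set where
    field
      board  : Board C B
      light  : danger C B ≤ c * slack C
      spread : ∀ z → deficit k C z ≢ 0 → 16 * c * threat C B z + danger C B ≤ 8 * c * slack C

  record Available (C B : Graph n) (x y : Fin n) : Set where
    field
      open-x    : deficit k C x ≢ 0
      open-y    : deficit k C y ≢ 0
      unblocked : adj B x y ≡ false
      far       : ball C t x y ≡ false

  -- Joining `x` and `y` lowers the slack by 2 and the danger by twice the sum of their threats. The
  -- conditions say that afterwards both invariants still hold with enough reserve for any reply: an
  -- edge of Blocker adds at most `2 * K` to the danger and `k` to a threat.
  record Move (C B : Graph n) (x y : Fin n) : Set where
    field
      available : Available C B x y
      light     : danger C B + 2 * K + 2 * c ≤ c * slack C + 2 * (threat C B x + threat C B y)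
      spread    : ∀ z → deficit k C z ≢ 0 →
                  16 * c * (threat C B z + k) + danger C B + 2 * K + 16 * c ≤ 8 * c * slack C + 2 * (threat C B x + threat C B y)

  -- Edges are stored with the smaller end first, whereas `x` is chosen as the most threatened
  -- vertex.
  Move-sym : {C B : Graph n} {x y : Fin n} → Move C B x y → Move C B y x
  Move-sym {C = C} {B} {x} {y} move = record
    { available = record
      { open-x = open-y ; open-y = open-x
      ; unblocked = trans (adj-sym B y x) unblocked
      ; far = ≢true⇒false (λ h → true≢false (ball-sym C t h) far) }
    ; light  = subst (λ a → danger C B + 2 * K + 2 * c ≤ c * slack C + 2 * a) (+-comm (threat C B x) (threat C B y)) light
    ; spread = λ z dz → subst (λ a → 16 * c * (threat C B z + k) + danger C B + 2 * K + 16 * c ≤ 8 * c * slack C + 2 * a)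
                              (+-comm (threat C B x) (threat C B y)) (spread z dz) }
    where
    open Move move
    open Available available

  module Search {C B : Graph n} (degrees : ∀ v → degree C v ≤ k) where

    d : Fin n → ℕ
    d = deficit k C

    find-available : {x : Fin n} → d x ≢ 0 → (ψ : Fin n → ℕ) (q m : ℕ) → (∀ y → d y ≢ 0 → ψ y ≤ m) →
           (∃[ y ] Available C B x y × q ≤ ψ y) ⊎ (dot d ψ ≤ q * ∑ d + m * (threat C B x + R))
    find-available {x} dx ψ q m ψ≤m with anyB (λ y → not (d y ≡ᵇ 0) ∧ (not (adj B x y) ∧ (not (ball C t x y) ∧ (q ≤ᵇ ψ y)))) in eq
    ... | true with y , p ← anyB⁻ {p = λ y → not (d y ≡ᵇ 0) ∧ (not (adj B x y) ∧ (not (ball C t x y) ∧ (q ≤ᵇ ψ y)))} eq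
               with p₁ , p₂ ← ∧-true⁻ p with p₃ , p₄ ← ∧-true⁻ p₂ with p₅ , p₆ ← ∧-true⁻ {p = not (ball C t x y)} p₄ = inj₁ (y ,
      record { open-x = dx ; open-y = λ dy≡0 → true≢false (Equivalence.to T-≡ (≡⇒≡ᵇ (d y) 0 dy≡0)) (not-true⁻ p₁)
             ; unblocked = not-true⁻ p₃ ; far = not-true⁻ p₅ } ,
      ≤ᵇ⇒≤ q (ψ y) (Equivalence.from T-≡ p₆))
    ... | false = inj₂ (begin
      dot d ψ                                             ≤⟨ ∑-mono pointwise ⟩
      ∑ (λ y → q * d y + m * (adjM B x y * d y + near y * k))
                                                          ≡⟨ ∑-+ (λ y → q * d y) (λ y → m * (adjM B x y * d y + near y * k)) ⟩
      ∑ (λ y → q * d y) + ∑ (λ y → m * (adjM B x y * d y + near y * k))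
                                                          ≡⟨ cong₂ _+_ (sym (*-distribˡ-∑ q d)) (trans (sym (*-distribˡ-∑ m _)) (cong (m *_) (∑-+ (λ y → adjM B x y * d y) (λ y → near y * k)))) ⟩
      q * ∑ d + m * (threat C B x + ∑ (λ y → near y * k)) ≤⟨ +-monoʳ-≤ (q * ∑ d) (*-monoʳ-≤ m (+-monoʳ-≤ (threat C B x)
        (≤-trans (≤-reflexive (sym (*-distribʳ-∑ k near))) (*-monoˡ-≤ k (ball-size C degrees t x))))) ⟩
      q * ∑ d + m * (threat C B x + R)                    ∎)
      where
      open ≤-Reasoning
      near : Fin n → ℕ
      near y = χ (ball C t x y)
      not-available : ∀ y → d y ≢ 0 → adj B x y ≡ false → ball C t x y ≡ false → ψ y ≤ q
      not-available y dy xy far with ψ y ≤? q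
      ... | yes le = le
      ... | no  gt = ⊥-elim (true≢false (anyB⁺ {p = λ y → not (d y ≡ᵇ 0) ∧ (not (adj B x y) ∧ (not (ball C t x y) ∧ (q ≤ᵇ ψ y)))} {y}
        (∧-true⁺ (not-true⁺ (≢true⇒false (λ h → dy (≡ᵇ⇒≡ (d y) 0 (Equivalence.from T-≡ h)))))
        (∧-true⁺ (not-true⁺ xy) (∧-true⁺ (not-true⁺ far) (Equivalence.to T-≡ (≤⇒≤ᵇ (<⇒≤ (≰⇒> gt)))))))) eq)
      pointwise : ∀ y → d y * ψ y ≤ q * d y + m * (adjM B x y * d y + near y * k)
      pointwise y with d y ≟ 0
      ... | yes dy≡0 = ≤-trans (≤-reflexive (cong (_* ψ y) dy≡0)) z≤n
      ... | no  dy with adj B x y in xy | ball C t x y in b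
      ...   | true  | _     = ≤-trans (*-monoʳ-≤ (d y) (ψ≤m y dy)) (≤-trans (≤-reflexive (*-comm (d y) m))
                                (≤-trans (*-monoʳ-≤ m (≤-trans (≤-reflexive (sym (+-identityʳ (d y)))) (m≤m+n (d y + 0) _))) (m≤n+m _ (q * d y))))
      ...   | false | true  = ≤-trans (*-mono-≤ (m∸n≤m k (degree C y)) (ψ≤m y dy)) (≤-trans (≤-reflexive (*-comm k m))
                                (≤-trans (*-monoʳ-≤ m (≤-reflexive (sym (+-identityʳ k)))) (m≤n+m _ (q * d y))))
      ...   | false | false = ≤-trans (*-monoʳ-≤ (d y) (not-available y dy xy b)) (≤-trans (≤-reflexive (*-comm (d y) q)) (m≤m+n _ _))

  module Choice {C B : Graph n} (position : Position C B) (large : threshold < slack C) where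
    open Position position
    open Board board

    W Φ : ℕ
    W = slack C
    Φ = danger C B

    large₁ : 2 * R < W
    large₁ = ≤-trans (s≤s (≤-trans (m≤m+n (2 * R) _) (m≤m+n _ _))) large

    large₂ : 32 * c * k + 4 * K + 32 * c ≤ W
    large₂ = ≤-trans (≤-trans (m≤n+m _ (2 * R)) (m≤m+n _ _)) (<⇒≤ large)

    large₃ : E * (E + R) + 2 * K + 2 * c ≤ W
    large₃ = ≤-trans (m≤n+m _ (2 * R + (32 * c * k + 4 * K + 32 * c))) (<⇒≤ large)

    largest : ∃[ x ] deficit k C x ≢ 0 × (∀ z → deficit k C z ≢ 0 → threat C B z ≤ threat C B x)
    largest with i , di ← ∑≢0 {u = deficit k C} (λ W≡0 → n≮0 (subst (threshold <_) W≡0 large)) = argmax (deficit k C) (threat C B) di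

    x : Fin n
    x = proj₁ largest

    dx : deficit k C x ≢ 0
    dx = proj₁ (proj₂ largest)

    threat≤ : ∀ z → deficit k C z ≢ 0 → threat C B z ≤ threat C B x
    threat≤ = proj₂ (proj₂ largest)

    μ : ℕ
    μ = threat C B x

    2μ≤W : 2 * μ ≤ W
    2μ≤W = *-cancelˡ-≤ (8 * c) (≤-trans (≤-reflexive (regroup c μ)) (≤-trans (m≤m+n _ Φ) (spread x dx)))
      where
      regroup : ∀ c m → 8 * c * (2 * m) ≡ 16 * c * m
      regroup = solve-∀

    some-available : ∃[ y ] Available C B x y
    some-available with Search.find-available {B = B} degrees dx (λ _ → 1) 0 1 (λ _ _ → ≤-refl)
    ... | inj₁ (y , av , _) = y , av
    ... | inj₂ bound = ⊥-elim (1+n≰n (begin-strict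
      W + W             ≤⟨ +-mono-≤ W≤ W≤ ⟩
      (μ + R) + (μ + R) ≡⟨ regroup μ R ⟩
      2 * μ + 2 * R     <⟨ +-mono-≤-< 2μ≤W large₁ ⟩
      W + W             ∎))
      where
      open ≤-Reasoning
      regroup : ∀ a b → (a + b) + (a + b) ≡ 2 * a + 2 * b
      regroup = solve-∀
      W≤ : W ≤ μ + R
      W≤ = ≤-trans (≤-reflexive (∑-cong (λ i → sym (*-identityʳ (deficit k C i))))) (≤-trans bound (≤-reflexive (*-identityˡ (μ + R))))

    -- The condition on `spread` holds for every partner, since `x` is a most threatened vertex.
    Move-from : ∀ {y} → Available C B x y → Φ + 2 * K + 2 * c ≤ c * W + 2 * (μ + threat C B y) → Move C B x y
    Move-from {y} av lt = record { available = av ; light = lt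
      ; spread = λ z dz → spread-arith c K k μ W Φ (threat C B y) (threat C B z) (s≤s z≤n) (threat≤ z dz) (spread x dx) light large₂ }

    Move-if-slack : Φ + 2 * K + 2 * c ≤ c * W + 2 * μ → ∃[ y ] Move C B x y
    Move-if-slack h with y , av ← some-available =
      y , Move-from av (≤-trans h (+-monoʳ-≤ (c * W) (*-monoʳ-≤ 2 (m≤m+n μ (threat C B y)))))

    -- By `light`, threats of total `K + c` suffice. Any partner will do if `x` alone provides them
    -- or if the danger is well below its bound. In the remaining case `x` provides `c` and the
    -- partner provides `K`.
    good-move : ∃[ y ] Move C B x y
    good-move with K + c ≤? μ
    ... | yes big = Move-if-slack (≤-trans (≤-reflexive (regroup Φ K c)) (+-mono-≤ light (*-monoʳ-≤ 2 big)))
      where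
      regroup : ∀ a b c → a + 2 * b + 2 * c ≡ a + 2 * (b + c)
      regroup = solve-∀
    ... | no small with Φ + 2 * K + 2 * c ≤? c * W
    ...   | yes room = Move-if-slack (≤-trans room (m≤m+n (c * W) _))
    ...   | no tight with Search.find-available {B = B} degrees dx (threat C B) K μ threat≤
    ...     | inj₁ (y , av , K≤) = y , Move-from av (≤-trans (≤-reflexive (regroup Φ K c)) (+-mono-≤ light (*-monoʳ-≤ 2 (≤-trans (≤-reflexive (+-comm K c)) (+-mono-≤ c≤μ K≤)))))
      where
      open ≤-Reasoning
      regroup : ∀ a b c → a + 2 * b + 2 * c ≡ a + 2 * (b + c)
      regroup = solve-∀
      -- Otherwise Φ ≤ K W, far below c W.
      c≤μ : c ≤ μ
      c≤μ with c ≤? μ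
      ... | yes le = le
      ... | no  gt = ⊥-elim (tight (begin
        Φ + 2 * K + 2 * c         ≡⟨ +-assoc Φ (2 * K) (2 * c) ⟩
        Φ + (2 * K + 2 * c)       ≤⟨ +-mono-≤ Φ≤ (≤-trans (≤-trans (m≤n+m (2 * K + 2 * c) (E * (E + R))) (≤-reflexive (sym (+-assoc (E * (E + R)) (2 * K) (2 * c))))) large₃) ⟩
        K * W + W                 ≡⟨ +-comm (K * W) W ⟩
        c * W                     ∎))
        where
        Φ≤ : Φ ≤ K * W
        Φ≤ = ≤-trans (∑-mono pointwise) (≤-reflexive (sym (*-distribˡ-∑ K (deficit k C))))
          where
          pointwise : ∀ i → deficit k C i * threat C B i ≤ K * deficit k C i
          pointwise i with deficit k C i ≟ 0
          ... | yes eq = ≤-trans (≤-reflexive (cong (_* threat C B i) eq)) z≤n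
          ... | no neq = ≤-trans (*-monoʳ-≤ (deficit k C i) (≤-trans (threat≤ i neq) (s≤s⁻¹ (≰⇒> gt)))) (≤-reflexive (*-comm (deficit k C i) K))
    ...     | inj₂ bound = ⊥-elim (tight (begin
        Φ + 2 * K + 2 * c                       ≡⟨ +-assoc Φ (2 * K) (2 * c) ⟩
        Φ + (2 * K + 2 * c)                     ≤⟨ +-monoˡ-≤ _ (≤-trans bound (+-monoʳ-≤ (K * W) (*-mono-≤ μ≤E (+-monoˡ-≤ R μ≤E)))) ⟩
        K * W + E * (E + R) + (2 * K + 2 * c)   ≡⟨ regroup (K * W) (E * (E + R)) (2 * K) (2 * c) ⟩
        K * W + (E * (E + R) + 2 * K + 2 * c)   ≤⟨ +-monoʳ-≤ (K * W) large₃ ⟩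
        K * W + W                               ≡⟨ +-comm (K * W) W ⟩
        c * W                                   ∎))
      where
      open ≤-Reasoning
      regroup : ∀ a b c d → a + b + (c + d) ≡ a + (b + c + d)
      regroup = solve-∀
      K+c≡E : ∀ K → K + suc K ≡ suc (2 * K)
      K+c≡E = solve-∀
      μ≤E : μ ≤ E
      μ≤E = ≤-trans (<⇒≤ (≰⇒> small)) (≤-reflexive (K+c≡E K))

-- The invariants under the moves of both players

loopless-ordered : {G : Graph n} → (∀ {u v} → (u , v) ∈ G → toℕ u < toℕ v) → Loopless G
loopless-ordered {G = G} ordered v = ≢true⇒false (λ vv → n≮n (toℕ v) (lemma (adj⁻ {G = G} vv)))
  where
  lemma : (v , v) ∈ G ⊎ (v , v) ∈ G → toℕ v < toℕ v
  lemma (inj₁ e) = ordered e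
  lemma (inj₂ e) = ordered e

loopless-∷ : {G : Graph n} {x y : Fin n} → x ≢ y → Loopless G → Loopless ((x , y) ∷ G)
loopless-∷ {G = G} {x} {y} x≢y loopless v = ≢true⇒false (λ vv → absurd (adj⁻ {G = (x , y) ∷ G} vv))
  where
  in-G : (v , v) ∈ (x , y) ∷ G → (v , v) ∈ G
  in-G (here refl) = contradiction refl x≢y
  in-G (there e∈)  = e∈
  absurd : (v , v) ∈ (x , y) ∷ G ⊎ (v , v) ∈ (x , y) ∷ G → ⊥
  absurd (inj₁ e) = true≢false (adj⁺ (in-G e)) (loopless v)
  absurd (inj₂ e) = true≢false (adj⁺ (in-G e)) (loopless v)

degree-[] : (v : Fin n) → degree [] v ≡ 0
degree-[] v = trans (degree≡∑ [] v) (∑-zero (λ _ → refl))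

module Moves (k t : ℕ) (1≤t : 1 ≤ t) where
  open Game k t

  -- The extra `2 * K` in the danger and `k` in each threat are the reserve that the next edge of
  -- Blocker may consume.
  record AfterMove (C B : Graph n) : Set where
    field
      board  : Board C B
      light  : danger C B + 2 * K ≤ c * slack C
      spread : ∀ z → deficit k C z ≢ 0 → 16 * c * (threat C B z + k) + danger C B + 2 * K ≤ 8 * c * slack C

  initial : Position {n} [] []
  initial {n} = record
    { board = record { C-loopless = λ _ → refl ; B-loopless = λ _ → refl
                     ; degrees = λ v → ≤-trans (≤-reflexive (degree-[] v)) z≤n
                     ; sparse = λ s _ s≥1 _ → ≤-trans (≤-reflexive (cong (_+ 2) (form-zero s))) (*-monoʳ-≤ 2 s≥1) }
    ; light = ≤-trans (≤-reflexive (form-zero (deficit k []))) z≤n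
    ; spread = λ z _ → ≤-trans (≤-reflexive (cong₂ _+_ (trans (cong (16 * c *_) (app-zero (deficit k []) z)) (*-zeroʳ (16 * c))) (form-zero (deficit k [])))) z≤n
    }
    where
    app-zero : (s : Fin n → ℕ) (i : Fin n) → app (adjM []) s i ≡ 0
    app-zero s i = ∑-zero (λ _ → refl)
    form-zero : (s : Fin n → ℕ) → form (adjM []) s ≡ 0
    form-zero s = ∑-zero (λ i → trans (cong (s i *_) (app-zero s i)) (*-zeroʳ (s i)))

  -- Lets a turn of Blocker without an unclaimed edge be treated as a `Position`.
  pass : {C B : Graph n} → AfterMove C B → Position C B
  pass {C = C} {B} after = record
    { board = board ; light = ≤-trans (m≤m+n _ _) light
    ; spread = λ z dz → ≤-trans (≤-trans (+-monoˡ-≤ (danger C B) (*-monoʳ-≤ (16 * c) (m≤m+n (threat C B z) k))) (m≤m+n _ _)) (spread z dz) }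
    where open AfterMove after

  block : {C B : Graph n} {u v : Fin n} → u ≢ v → AfterMove C B → Position C ((u , v) ∷ B)
  block {n} {C} {B} {u} {v} u≢v after = record
    { board  = record { C-loopless = C-loopless ; B-loopless = loopless-∷ {G = B} u≢v B-loopless ; degrees = degrees ; sparse = sparse }
    ; light  = ≤-trans danger≤ light
    ; spread = λ z dz → ≤-trans (+-mono-≤ (*-monoʳ-≤ (16 * c) (threat≤ z)) danger≤)
        (≤-trans (≤-reflexive (sym (+-assoc (16 * c * (threat C B z + k)) (danger C B) (2 * K)))) (spread z dz)) }
    where
    open AfterMove after
    open Board board
    d≤k : ∀ z → deficit k C z ≤ k
    d≤k z = m∸n≤m k (degree C z)
    danger≤ : danger C ((u , v) ∷ B) ≤ danger C B + 2 * K
    danger≤ = ≤-trans (form-mono (adjM-∷≤ B u v) (deficit k C)) (≤-trans (≤-reflexive (form-pairM (adjM B) u v (deficit k C)))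
      (+-monoʳ-≤ (danger C B) (*-monoʳ-≤ 2 (*-mono-≤ (d≤k u) (d≤k v)))))
    threat≤ : ∀ z → threat C ((u , v) ∷ B) z ≤ threat C B z + k
    threat≤ z = ≤-trans (dot-mono {v = deficit k C} (adjM-∷≤ B u v z) (λ _ → ≤-refl)) (≤-trans (≤-reflexive (app-pairM (adjM B) u v (deficit k C) z))
      (+-monoʳ-≤ (threat C B z) one-end))
      where
      one-end : δ u z * deficit k C v + δ v z * deficit k C u ≤ k
      one-end with u ≟ᶠ z | v ≟ᶠ z
      ... | yes refl | yes refl = contradiction refl u≢v
      ... | yes _    | no  _    = ≤-trans (≤-reflexive (trans (+-identityʳ _) (+-identityʳ _))) (d≤k v)
      ... | no  _    | yes _    = ≤-trans (≤-reflexive (+-identityʳ _)) (d≤k u)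
      ... | no  _    | no  _    = z≤n

  far⇒≢ : {C : Graph n} {x y : Fin n} → ball C t x y ≡ false → x ≢ y
  far⇒≢ {C = C} {x} far refl = true≢false (ball-refl C t x) far

  far⇒nonadjacent : {C : Graph n} {x y : Fin n} → ball C t x y ≡ false → adj C x y ≡ false
  far⇒nonadjacent {C = C} {x} far = ≢true⇒false (λ xy → true≢false (ball-mono C {1} (≤⇒≤′ 1≤t) (ball-step C 0 (=ᶠ-refl x) xy)) far)

  claim : {C B : Graph n} {x y : Fin n} → Board C B → Move C B x y → AfterMove ((x , y) ∷ C) B
  claim {n} {C} {B} {x} {y} board move = record
    { board  = record { C-loopless = loopless-∷ {G = C} x≢y C-loopless ; B-loopless = B-loopless
                      ; degrees = degrees′ ; sparse = sparse-∷ C sparse far }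
    ; light  = +-cancelʳ-≤ (2 * s + 2 * c) _ _ (begin
        danger C′ B + 2 * K + (2 * s + 2 * c)   ≡⟨ regroup (danger C′ B) (2 * K) (2 * s) (2 * c) ⟩
        danger C′ B + 2 * s + 2 * K + 2 * c     ≡⟨ cong (λ a → a + 2 * K + 2 * c) (sym danger≡) ⟩
        danger C B + 2 * K + 2 * c              ≤⟨ Move.light move ⟩
        c * slack C + 2 * s                     ≡⟨ cong (λ a → c * a + 2 * s) slack≡ ⟩
        c * (slack C′ + 2) + 2 * s              ≡⟨ regroup₁ c (slack C′) s ⟩
        c * slack C′ + (2 * s + 2 * c)          ∎)
    ; spread = λ z d′z → +-cancelʳ-≤ (2 * s + 16 * c) _ _ (begin
        16 * c * (threat C′ B z + k) + danger C′ B + 2 * K + (2 * s + 16 * c)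
          ≤⟨ +-monoˡ-≤ _ (+-monoˡ-≤ (2 * K) (+-monoˡ-≤ (danger C′ B) (*-monoʳ-≤ (16 * c) (+-monoˡ-≤ k (threat≤ z))))) ⟩
        16 * c * (threat C B z + k) + danger C′ B + 2 * K + (2 * s + 16 * c)
          ≡⟨ regroup₂ (16 * c * (threat C B z + k)) (danger C′ B) (2 * K) (2 * s) (16 * c) ⟩
        16 * c * (threat C B z + k) + (danger C′ B + 2 * s) + 2 * K + 16 * c
          ≡⟨ cong (λ a → 16 * c * (threat C B z + k) + a + 2 * K + 16 * c) (sym danger≡) ⟩
        16 * c * (threat C B z + k) + danger C B + 2 * K + 16 * c
          ≤⟨ Move.spread move z (λ dz≡0 → d′z (n≤0⇒n≡0 (≤-trans (d′≤d z) (≤-reflexive dz≡0)))) ⟩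
        8 * c * slack C + 2 * s                 ≡⟨ cong (λ a → 8 * c * a + 2 * s) slack≡ ⟩
        8 * c * (slack C′ + 2) + 2 * s          ≡⟨ regroup₃ c (slack C′) s ⟩
        8 * c * slack C′ + (2 * s + 16 * c)     ∎)
    }
    where
    open ≤-Reasoning
    open Board board
    open Available (Move.available move)
    C′ : Graph n
    C′ = (x , y) ∷ C
    d d′ σ : Fin n → ℕ
    d  = deficit k C
    d′ = deficit k C′
    σ v = δ x v + δ y v
    s : ℕ
    s = threat C B x + threat C B y
    regroup : ∀ a b c d → a + b + (c + d) ≡ a + c + b + d
    regroup = solve-∀
    regroup₁ : ∀ c w s → c * (w + 2) + 2 * s ≡ c * w + (2 * s + 2 * c)
    regroup₁ = solve-∀
    regroup₂ : ∀ a b c d e → a + b + c + (d + e) ≡ a + (b + d) + c + e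
    regroup₂ = solve-∀
    regroup₃ : ∀ c w s → 8 * c * (w + 2) + 2 * s ≡ 8 * c * w + (2 * s + 16 * c)
    regroup₃ = solve-∀
    x≢y : x ≢ y
    x≢y = far⇒≢ {C = C} far
    degree≡ : ∀ v → degree C′ v ≡ degree C v + σ v
    degree≡ = degree-∷ C x≢y (far⇒nonadjacent {C = C} far)
    σ≤d : ∀ v → σ v ≤ d v
    σ≤d v with x ≟ᶠ v | y ≟ᶠ v
    ... | yes refl | yes refl = contradiction refl x≢y
    ... | yes refl | no  _    = n≢0⇒n>0 open-x
    ... | no  _    | yes refl = n≢0⇒n>0 open-y
    ... | no  _    | no  _    = z≤n
    d≡ : ∀ v → d v ≡ d′ v + σ v
    d≡ v = sym (trans (cong (_+ σ v) (trans (cong (k ∸_) (degree≡ v)) (sym (∸-+-assoc k (degree C v) (σ v))))) (m∸n+n≡m (σ≤d v)))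
    d′≤d : ∀ v → d′ v ≤ d v
    d′≤d v = ≤-trans (m≤m+n _ _) (≤-reflexive (sym (d≡ v)))
    degrees′ : ∀ v → degree C′ v ≤ k
    degrees′ v = ≤-trans (≤-reflexive (degree≡ v)) (≤-trans (+-monoʳ-≤ (degree C v) (σ≤d v)) (≤-reflexive (m+[n∸m]≡n (degrees v))))
    dot-σ : (w : Fin n → ℕ) → dot σ w ≡ w x + w y
    dot-σ w = trans (dot-+ˡ (δ x) (δ y) w) (cong₂ _+_ (dot-δ x w) (dot-δ y w))
    slack≡ : slack C ≡ slack C′ + 2
    slack≡ = trans (∑-cong d≡) (trans (∑-+ d′ σ) (cong (slack C′ +_) (trans (∑-cong (λ v → sym (*-identityʳ (σ v)))) (dot-σ (λ _ → 1)))))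
    threat≤ : ∀ z → threat C′ B z ≤ threat C B z
    threat≤ z = dot-mono {u = adjM B z} (λ _ → ≤-refl) d′≤d
    M : Matrix n
    M = adjM B
    app-σ : ∀ i → app M σ i ≡ M i x + M i y
    app-σ i = trans (dot-+ʳ (M i) (δ x) (δ y)) (cong₂ _+_ (app-δ M x i) (app-δ M y i))
    app-σx : app M σ x ≡ 0
    app-σx = trans (app-σ x) (cong₂ _+_ (χ-false (B-loopless x)) (χ-false unblocked))
    app-σy : app M σ y ≡ 0
    app-σy = trans (app-σ y) (cong₂ _+_ (χ-false (trans (adj-sym B y x) unblocked)) (χ-false (B-loopless y)))
    app-split : ∀ i → app M d i ≡ app M d′ i + app M σ i
    app-split i = trans (∑-cong (λ j → cong (M i j *_) (d≡ j))) (dot-+ʳ (M i) d′ σ)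
    cross : dot d′ (app M σ) ≡ s
    cross = trans (dot-app-sym (adjM-sym B) d′ σ) (trans (dot-σ (app M d′)) (cong₂ _+_ (old x app-σx) (old y app-σy)))
      where
      old : ∀ i → app M σ i ≡ 0 → app M d′ i ≡ app M d i
      old i eq = sym (trans (app-split i) (trans (cong (app M d′ i +_) eq) (+-identityʳ _)))
    -- As Blocker has no edge between `x` and `y`, the form vanishes on `σ`, and lowering the two
    -- deficits leaves the threats to `x` and `y` unchanged; the mixed term is therefore exactly
    -- `s`.
    danger≡ : danger C B ≡ danger C′ B + 2 * s
    danger≡ = trans (form-cong M d≡) (trans (form-+ (adjM-sym B) d′ σ)
      (cong₂ _+_ (trans (cong (form M d′ +_) (trans (dot-σ (app M σ)) (cong₂ _+_ app-σx app-σy))) (+-identityʳ _)) (cong (2 *_) cross)))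

-- Bounds on the value of the game

foldr-⊔-base : (h : A → ℕ) (b : ℕ) (xs : List A) → b ≤ foldr (λ x acc → acc ⊔ h x) b xs
foldr-⊔-base h b []       = ≤-refl
foldr-⊔-base h b (x ∷ xs) = ≤-trans (foldr-⊔-base h b xs) (m≤m⊔n _ _)

foldr-⊔-∈ : (h : A → ℕ) (b : ℕ) {xs : List A} {x : A} → x ∈ xs → h x ≤ foldr (λ x acc → acc ⊔ h x) b xs
foldr-⊔-∈ h b {y ∷ xs} (here refl) = m≤n⊔m _ _
foldr-⊔-∈ h b {y ∷ xs} (there x∈)  = ≤-trans (foldr-⊔-∈ h b x∈) (m≤m⊔n _ _)

foldr-⊔-lub : (h : A → ℕ) {b v : ℕ} (xs : List A) → b ≤ v → (∀ {x} → x ∈ xs → h x ≤ v) → foldr (λ x acc → acc ⊔ h x) b xs ≤ v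
foldr-⊔-lub h []       b≤v h≤v = b≤v
foldr-⊔-lub h (x ∷ xs) b≤v h≤v = ⊔-lub (foldr-⊔-lub h xs b≤v (h≤v ∘ there)) (h≤v (here refl))

foldr-⊓-base : (h : A → ℕ) (b : ℕ) (xs : List A) → foldr (λ x acc → acc ⊓ h x) b xs ≤ b
foldr-⊓-base h b []       = ≤-refl
foldr-⊓-base h b (x ∷ xs) = ≤-trans (m⊓n≤m _ _) (foldr-⊓-base h b xs)

foldr-⊓-glb : (h : A → ℕ) {b v : ℕ} (xs : List A) → v ≤ b → (∀ {x} → x ∈ xs → v ≤ h x) → v ≤ foldr (λ x acc → acc ⊓ h x) b xs
foldr-⊓-glb h []       v≤b v≤h = v≤b
foldr-⊓-glb h (x ∷ xs) v≤b v≤h = ⊓-glb (foldr-⊓-glb h xs v≤b (v≤h ∘ there)) (v≤h (here refl))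

module Turns {t s : ℕ} (n : ℕ) (H : Graph t) (F : Graph s) where

  options : Graph n → Graph n → List (Edge n)
  options C B = filterᵇ (λ e → freeᵇ F (e ∷ C)) (unclaimed n C B)

  constructor≥-copies : ∀ fuel C B {v} → v ≤ copies H C → (∀ {e} → e ∈ options C B → v ≤ blockerTurn n H F fuel (e ∷ C) B) →
                        v ≤ constructorTurn n H F (suc fuel) C B
  constructor≥-copies fuel C B v≤copies v≤blocker with options C B
  ... | []     = v≤copies
  ... | e ∷ es = ≤-trans (v≤blocker (here refl)) (foldr-⊔-base _ _ es)

  constructor≥-option : ∀ fuel C B {e} → e ∈ options C B → blockerTurn n H F fuel (e ∷ C) B ≤ constructorTurn n H F (suc fuel) C B
  constructor≥-option fuel C B e∈ with options C B
  constructor≥-option fuel C B (here refl) | e ∷ es = foldr-⊔-base _ _ es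
  constructor≥-option fuel C B (there e∈)  | e ∷ es = foldr-⊔-∈ (λ e → blockerTurn n H F fuel (e ∷ C) B) _ e∈

  constructor≤ : ∀ fuel C B {v} → copies H C ≤ v → (∀ {e} → e ∈ options C B → blockerTurn n H F fuel (e ∷ C) B ≤ v) →
                 constructorTurn n H F (suc fuel) C B ≤ v
  constructor≤ fuel C B copies≤v blocker≤v with options C B
  ... | []     = copies≤v
  ... | e ∷ es = foldr-⊔-lub _ es (blocker≤v (here refl)) (blocker≤v ∘ there)

  blocker≥ : ∀ fuel C B {v} → (unclaimed n C B ≡ [] → v ≤ copies H C) →
             (∀ {e} → e ∈ unclaimed n C B → v ≤ constructorTurn n H F fuel C (e ∷ B)) →
             v ≤ blockerTurn n H F (suc fuel) C B
  blocker≥ fuel C B v≤copies v≤constructor with unclaimed n C B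
  ... | []     = v≤copies refl
  ... | e ∷ es = foldr-⊓-glb _ es (v≤constructor (here refl)) (v≤constructor ∘ there)

  blocker≤ : ∀ fuel C B {v} → copies H C ≤ v →
             (∀ {e} → e ∈ unclaimed n C B → constructorTurn n H F fuel C (e ∷ B) ≤ v) →
             blockerTurn n H F (suc fuel) C B ≤ v
  blocker≤ fuel C B copies≤v constructor≤v with unclaimed n C B
  ... | []     = copies≤v
  ... | e ∷ es = ≤-trans (foldr-⊓-base _ _ es) (constructor≤v (here refl))

  module _ (P : Graph n → Set) (v : ℕ) (P-∷ : ∀ {e C} → P C → P (e ∷ C)) (P⇒v≤ : ∀ {C} → P C → v ≤ copies H C) where

    -- A property kept by all further edges of Constructor needs no strategy once it is attained.
    constructor-secures : ∀ fuel C B → P C → v ≤ constructorTurn n H F fuel C B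
    blocker-secures : ∀ fuel C B → P C → v ≤ blockerTurn n H F fuel C B

    constructor-secures zero       C B PC = P⇒v≤ PC
    constructor-secures (suc fuel) C B PC = constructor≥-copies fuel C B (P⇒v≤ PC) (λ {e} _ → blocker-secures fuel (e ∷ C) B (P-∷ PC))

    blocker-secures zero       C B PC = P⇒v≤ PC
    blocker-secures (suc fuel) C B PC = blocker≥ fuel C B (λ _ → P⇒v≤ PC) (λ {e} _ → constructor-secures fuel C (e ∷ B) PC)

  module _ (P : Graph n → Set) (v : ℕ) (P-option : ∀ {e C B} → e ∈ options C B → P C → P (e ∷ C)) (P⇒≤v : ∀ {C} → P C → copies H C ≤ v) where

    -- Here `P` has to survive legal moves only, so it may record freeness of Constructor's graph.
    constructor-limited : ∀ fuel C B → P C → constructorTurn n H F fuel C B ≤ v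
    blocker-limited : ∀ fuel C B → P C → blockerTurn n H F fuel C B ≤ v

    constructor-limited zero       C B PC = P⇒≤v PC
    constructor-limited (suc fuel) C B PC = constructor≤ fuel C B (P⇒≤v PC) (λ {e} e∈ → blocker-limited fuel (e ∷ C) B (P-option {B = B} e∈ PC))

    blocker-limited zero       C B PC = P⇒≤v PC
    blocker-limited (suc fuel) C B PC = blocker≤ fuel C B (P⇒≤v PC) (λ {e} _ → constructor-limited fuel C (e ∷ B) PC)

-- Playing the strategy on the unclaimed edges

unclaimed-∈⁺ : {C B : Graph n} {u v : Fin n} → toℕ u < toℕ v → adj C u v ≡ false → adj B u v ≡ false → (u , v) ∈ unclaimed n C B
unclaimed-∈⁺ {C = C} {B} u<v uv∉C uv∉B = ∈-filterᵇ⁺ _ (∈-allEdges⁺ u<v)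
  (∧-true⁺ (not-true⁺ (≢true⇒false (λ h → true≢false (adj⁺ (memE⁻ {G = C} h)) uv∉C)))
           (not-true⁺ (≢true⇒false (λ h → true≢false (adj⁺ (memE⁻ {G = B} h)) uv∉B))))

unclaimed-∈⁻ : {C B : Graph n} {e : Edge n} → e ∈ unclaimed n C B → e ∈ allEdges n × memE e C ≡ false × memE e B ≡ false
unclaimed-∈⁻ {n} e∈ with e∈all , h ← ∈-filterᵇ⁻ _ (allEdges n) e∈ = let p , q = ∧-true⁻ h in e∈all , not-true⁻ p , not-true⁻ q

memE-∷-false : {e e′ : Edge n} {G : Graph n} → memE e (e′ ∷ G) ≡ false → memE e G ≡ false
memE-∷-false {e = e} {e′} {G} h = ≢true⇒false (λ p → true≢false (memE⁺ {G = e′ ∷ G} (there (memE⁻ {e = e} {G} p))) h)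

unclaimed-constructor : {C B : Graph n} {e : Edge n} → e ∈ unclaimed n C B → length (unclaimed n (e ∷ C) B) < length (unclaimed n C B)
unclaimed-constructor {n} {C} {B} {e} e∈ with e∈all , e∉C , e∉B ← unclaimed-∈⁻ {C = C} {B} e∈ =
  length-filterᵇ-strict
    (λ x h → let p , q = ∧-true⁻ {not (memE x (e ∷ C))} h in ∧-true⁺ (not-true⁺ (memE-∷-false {e = x} {e} {C} (not-true⁻ p))) q)
    e∈all (∧-true⁺ (not-true⁺ e∉C) (not-true⁺ e∉B))
    (≢true⇒false (λ h → true≢false (memE⁺ {G = e ∷ C} (here refl)) (not-true⁻ (proj₁ (∧-true⁻ {not (memE e (e ∷ C))} h)))))

unclaimed-blocker : {C B : Graph n} {e : Edge n} → e ∈ unclaimed n C B → length (unclaimed n C (e ∷ B)) < length (unclaimed n C B)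
unclaimed-blocker {n} {C} {B} {e} e∈ with e∈all , e∉C , e∉B ← unclaimed-∈⁻ {C = C} {B} e∈ =
  length-filterᵇ-strict
    (λ x h → let p , q = ∧-true⁻ {not (memE x C)} h in ∧-true⁺ p (not-true⁺ (memE-∷-false {e = x} {e} {B} (not-true⁻ q))))
    e∈all (∧-true⁺ (not-true⁺ e∉C) (not-true⁺ e∉B))
    (≢true⇒false (λ h → true≢false (memE⁺ {G = e ∷ B} (here refl)) (not-true⁻ (proj₂ (∧-true⁻ {not (memE e C)} h)))))

length≤0⇒[] : {xs : List A} → length xs ≤ 0 → xs ≡ []
length≤0⇒[] {xs = []} _ = refl

module Play (k t : ℕ) (1≤t : 1 ≤ t) {n : ℕ} (H : Graph t) (P : Graph n → Set) (v : ℕ)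
  (P-∷ : ∀ {e C} → P C → P (e ∷ C)) (P⇒v≤ : ∀ {C} → P C → v ≤ copies H C)
  (settled : ∀ {C B} → Game.Board k t C B → Game.slack k t C ≤ Game.threshold k t → P C) where

  open Game k t
  open Moves k t 1≤t
  open Turns n H (star (suc k))

  oriented-move : {C B : Graph n} → Position C B → threshold < slack C →
                  ∃[ x ] ∃[ y ] toℕ x < toℕ y × Move C B x y
  oriented-move {C} {B} position large with y , move ← Choice.good-move position large
    with <-cmp (toℕ (Choice.x position large)) (toℕ y)
  ... | tri< x<y _ _ = _ , y , x<y , move
  ... | tri> _ _ y<x = y , _ , y<x , Move-sym move
  ... | tri≈ _ x≡y _ = contradiction (Finₚ.toℕ-injective x≡y) (far⇒≢ {C = C} (Available.far (Move.available move)))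

  move-unclaimed : {C B : Graph n} {x y : Fin n} → toℕ x < toℕ y → Move C B x y → (x , y) ∈ unclaimed n C B
  move-unclaimed {C} {B} x<y move = unclaimed-∈⁺ {C = C} {B} x<y (far⇒nonadjacent {C = C} far) unblocked
    where open Available (Move.available move)

  -- With large slack there would be a good move, and its edge would be unclaimed; so a full board
  -- has small slack.
  blocked⇒P : {C B : Graph n} → Position C B → unclaimed n C B ≡ [] → P C
  blocked⇒P {C} {B} position none with slack C ≤? threshold
  ... | yes small = settled (Position.board position) small
  ... | no  large with x , y , x<y , move ← oriented-move position (≰⇒> large)
    with () ← subst ((x , y) ∈_) none (move-unclaimed x<y move)

  constructor-plays : ∀ fuel C B → Position C B → length (unclaimed n C B) ≤ fuel → v ≤ constructorTurn n H (star (suc k)) fuel C B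
  blocker-plays : ∀ fuel C B → AfterMove C B → length (unclaimed n C B) ≤ fuel → v ≤ blockerTurn n H (star (suc k)) fuel C B

  -- `fuel` bounds the number of unclaimed edges, so running out of it means that the board is full.
  constructor-plays zero C B position enough = P⇒v≤ (blocked⇒P position (length≤0⇒[] enough))
  constructor-plays (suc fuel) C B position enough with slack C ≤? threshold
  ... | yes small = constructor-secures P v P-∷ P⇒v≤ (suc fuel) C B (settled (Position.board position) small)
  ... | no  large with x , y , x<y , move ← oriented-move position (≰⇒> large) = ≤-trans
    (blocker-plays fuel C′ B after (s≤s⁻¹ (≤-trans (unclaimed-constructor {C = C} {B} e∈) enough)))
    (constructor≥-option fuel C B (∈-filterᵇ⁺ _ e∈ (degree≤⇒star-free {G = C′} (Board.degrees (AfterMove.board after)))))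
    where
    C′ : Graph n
    C′ = (x , y) ∷ C
    after : AfterMove C′ B
    after = claim (Position.board position) move
    e∈ : (x , y) ∈ unclaimed n C B
    e∈ = move-unclaimed x<y move

  blocker-plays zero C B after enough = P⇒v≤ (blocked⇒P (pass after) (length≤0⇒[] enough))
  blocker-plays (suc fuel) C B after enough = blocker≥ fuel C B (P⇒v≤ ∘ blocked⇒P (pass after))
    (λ {e} e∈ → constructor-plays fuel C (e ∷ B)
      (block (λ eq → <⇒≢ (∈-allEdges⁻ (proj₁ (unclaimed-∈⁻ {C = C} {B} e∈))) (cong toℕ eq)) after)
      (s≤s⁻¹ (≤-trans (unclaimed-blocker {C = C} {B} e∈) enough)))

  v≤g : v ≤ g n H (star (suc k))
  v≤g = constructor-plays (length (allEdges n)) [] [] initial (length-filterᵇ≤ _ (allEdges n))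

-- The extremal number and its comparison with the game

sublists⁻ : (xs : List A) {ys : List A} → ys ∈ sublists xs → ∀ {y} → y ∈ ys → y ∈ xs
sublists⁻ []       (here refl) ()
sublists⁻ (x ∷ xs) ys∈ y∈ with ∈-++⁻ (sublists xs) ys∈
... | inj₁ ys∈′ = there (sublists⁻ xs ys∈′ y∈)
... | inj₂ ys∈′ with zs , zs∈ , refl ← ∈-map⁻ (x ∷_) ys∈′ with y∈
...   | here refl = here refl
...   | there y∈′ = there (sublists⁻ xs zs∈ y∈′)

filterᵇ-∈-sublists : (p : A → Bool) (xs : List A) → filterᵇ p xs ∈ sublists xs
filterᵇ-∈-sublists p []       = here refl
filterᵇ-∈-sublists p (x ∷ xs) with p x
... | true  = ∈-++⁺ʳ (sublists xs) (∈-map⁺ (x ∷_) (filterᵇ-∈-sublists p xs))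
... | false = ∈-++⁺ˡ (filterᵇ-∈-sublists p xs)

≤maxL : {x : ℕ} {xs : List ℕ} → x ∈ xs → x ≤ maxL xs
≤maxL (here refl)            = m≤m⊔n _ _
≤maxL {xs = y ∷ _} (there x∈) = ≤-trans (≤maxL x∈) (m≤n⊔m y _)

maxL≤ : {v : ℕ} (xs : List ℕ) → (∀ {x} → x ∈ xs → x ≤ v) → maxL xs ≤ v
maxL≤ []       h = z≤n
maxL≤ (x ∷ xs) h = ⊔-lub (h (here refl)) (maxL≤ xs (h ∘ there))

ex≤ : (H : Graph t) (F : Graph m) {v : ℕ} →
      (∀ (G : Graph n) → (∀ {u v} → (u , v) ∈ G → toℕ u < toℕ v) → freeᵇ F G ≡ true → copies H G ≤ v) → ex n H F ≤ v
ex≤ {n = n} H F {v} h = maxL≤ _ (λ x∈ → bound (∈-map⁻ _ x∈))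
  where
  bound : ∀ {x} → ∃[ G ] G ∈ filterᵇ (freeᵇ F) (sublists (allEdges n)) × x ≡ copies H G → x ≤ v
  bound (G , G∈ , refl) with G∈′ , free ← ∈-filterᵇ⁻ (freeᵇ F) (sublists (allEdges n)) G∈ =
    h G (λ e∈ → ∈-allEdges⁻ (sublists⁻ (allEdges n) G∈′ e∈)) free

-- `ex` ranges over sublists of `allEdges n`, whereas `C` lists its edges in the order of play;
-- `sorted` is the sublist with the same adjacency.
≤ex : (H : Graph t) (F : Graph m) (C : Graph n) → (∀ {e} → e ∈ C → e ∈ allEdges n) → freeᵇ F C ≡ true → copies H C ≤ ex n H F
≤ex {n = n} H F C C⊆ free = ≤-trans (≤-reflexive (copies-cong {H = H} {C} {sorted} same))
  (≤maxL (∈-map⁺ (copies H) (∈-filterᵇ⁺ (freeᵇ F) (filterᵇ-∈-sublists (λ e → memE e C) (allEdges n))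
    (trans (cong (_≡ᵇ 0) (sym (copies-cong {H = F} {C} {sorted} same))) free))))
  where
  sorted : Graph n
  sorted = filterᵇ (λ e → memE e C) (allEdges n)
  to : ∀ {e} → e ∈ C → e ∈ sorted
  to e∈ = ∈-filterᵇ⁺ _ (C⊆ e∈) (memE⁺ e∈)
  from : ∀ {e} → e ∈ sorted → e ∈ C
  from {e} e∈ = memE⁻ {e = e} (proj₂ (∈-filterᵇ⁻ (λ e → memE e C) (allEdges n) e∈))
  adj-⊆ : {G G′ : Graph n} → (∀ {e} → e ∈ G → e ∈ G′) → ∀ u v → adj G u v ≡ true → adj G′ u v ≡ true
  adj-⊆ {G} {G′} sub u v uv with adj⁻ {G = G} uv
  ... | inj₁ e = adj⁺ (sub e)
  ... | inj₂ e = adj⁺′ (sub e)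
  same : ∀ u v → adj C u v ≡ adj sorted u v
  same u v = bool-ext (adj-⊆ to u v) (adj-⊆ from u v)

g≤ex : (H : Graph t) (k n : ℕ) → g n H (star (suc k)) ≤ ex n H (star (suc k))
g≤ex H k n = Turns.constructor-limited n H F Legal (ex n H F)
  (λ {e} {C} {B} e∈ (C⊆ , _) → let e∈unclaimed , free = ∈-filterᵇ⁻ (λ e → freeᵇ F (e ∷ C)) (unclaimed n C B) e∈ in
    (λ { (here refl) → proj₁ (unclaimed-∈⁻ {C = C} {B} e∈unclaimed) ; (there x∈) → C⊆ x∈ }) , free)
  (λ {C} (C⊆ , free) → ≤ex H F C C⊆ free)
  (length (allEdges n)) [] []
  ((λ ()) , degree≤⇒star-free {n} {[]} {k} (λ v → ≤-trans (≤-reflexive (degree-[] v)) z≤n))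
  where
  F : Graph (suc (suc k))
  F = star (suc k)
  Legal : Graph n → Set
  Legal C = (∀ {e} → e ∈ C → e ∈ allEdges n) × freeᵇ F C ≡ true

-- A star-free `G` has at most `n * weight k explored` embeddings, and `Rich` says that
-- Constructor's graph falls short of this by at most `loss`. Further edges preserve `Rich`, so it
-- is enough to attain it once the slack is at most `threshold`.
ex≤g+ : (k : ℕ) {T : Graph t} → Loopless T → {as : List (Fin t)} (explored : Explored T as) → (∀ x → x ∈ as) → 1 ≤ t →
        ∀ n → ex n T (star (suc k)) ≤ g n T (star (suc k)) + Game.threshold k t * suc k ^ t * weight k explored
ex≤g+ {t} k {T} T-loopless explored full 1≤t n = ex≤ T (star (suc k)) λ G ordered free →
  let loopless = loopless-ordered ordered
      upper    = embeddings≤ T-loopless G (star-free⇒degree≤ {G = G} loopless free) explored full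
      secured  = Play.v≤g k t 1≤t T Rich (copies T G ∸ loss)
        (λ {e} {C} rich → ≤-trans rich (+-monoˡ-≤ loss (embeddings-mono {H = T} {C} {e ∷ C} (λ u v → ∨-true⁺ʳ _))))
        (λ {C} rich → m≤n+o⇒m∸n≤o (copies T G) loss (copies-transfer G C (≤-trans upper rich)))
        (λ {C} board small → ≤-trans
          (embeddings≥ T-loopless {G = C} (Board.C-loopless board) (Board.sparse board) (Board.degrees board) explored full)
          (+-monoʳ-≤ _ (*-monoˡ-≤ (weight k explored) (*-monoˡ-≤ (suc k ^ t) small))))
  in ≤-trans (≤-trans (m≤n+m∸n (copies T G) loss) (+-monoʳ-≤ loss secured)) (≤-reflexive (+-comm loss _))
  where
  open Game k t
  loss : ℕ
  loss = threshold * suc k ^ t * weight k explored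
  Rich : Graph n → Set
  Rich C = n * weight k explored ≤ length (embeddings T C) + loss
  -- Division by `aut T`, which is at least 1, can only shrink the loss, so the same constant serves
  -- for copies.
  copies-transfer : (G C : Graph n) → length (embeddings T G) ≤ length (embeddings T C) + loss → copies T G ≤ loss + copies T C
  copies-transfer G C le = *-cancelʳ-≤ (copies T G) (loss + copies T C) (aut T) {{>-nonZero (aut≥1 T)}} (begin
    copies T G * aut T                    ≡⟨ sym (embeddings≡copies*aut T G) ⟩
    length (embeddings T G)               ≤⟨ le ⟩
    length (embeddings T C) + loss        ≡⟨ cong (_+ loss) (embeddings≡copies*aut T C) ⟩
    copies T C * aut T + loss             ≡⟨ +-comm _ loss ⟩
    loss + copies T C * aut T             ≤⟨ +-monoˡ-≤ _ (≤-trans (≤-reflexive (sym (*-identityʳ loss))) (*-monoʳ-≤ loss (aut≥1 T))) ⟩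
    loss * aut T + copies T C * aut T     ≡⟨ sym (*-distribʳ-+ (aut T) loss (copies T C)) ⟩
    (loss + copies T C) * aut T           ∎)
    where open ≤-Reasoning

theorem1p2 : (k : ℕ) → 2 ≤ k → (t : ℕ) (T : Graph t) → IsTree t T → MaxDegAtMost T k →
    ∃[ c ] ((n : ℕ) →
    (ex n T (star (suc k)) ≤ g n T (star (suc k)) + c) × (g n T (star (suc k)) ≤ ex n T (star (suc k))))
theorem1p2 k _ t T tree@((ordered , _) , _ , size) _ with as , explored , full ← tree-explored tree =
  _ , λ n → ex≤g+ k (loopless-ordered (All.lookup ordered)) explored full (subst (1 ≤_) size (m≤n+m 1 (length T))) n , g≤ex T k n
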